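{- For every integer $t\geq 4$, every graph $G$ that does not contain $K_t$ as a minor has a connected partition $H_1,\dots,H_\ell$ of width $t-2$ such that for every $i\in\{1,\dots,\ell\}$: (1) (a) $H_i$ has maximum degree at most $t-2$; (b) $H_i$ has bandwidth, pathwidth and treewidth at most $t-3$; (c) $H_i$ can be $2$-coloured with clustering $\lceil\tfrac12(t-2)\rceil$; (d) $H_i$ can be $2$-coloured with colours red and blue such that there are at most $t-4$ red vertices and the blue subgraph consists of at most $t-3$ pairwise vertex-disjoint paths; (2) every connected component $C$ of $G-(V(H_1)\cup\dots\cup V(H_i))$ satisfies: (a) at most $t-2$ of the subgraphs $H_1,\dots,H_i$ are adjacent to $C$, and these subgraphs are pairwise adjacent; (b) every vertex of $C$ is adjacent to at most $2t-6$ vertices in each of $H_1,\dots,H_i$.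
   Context: All graphs are finite and simple. A sequence $H_1,\dots,H_\ell$ is a connected partition of $G$ if each $H_i$ is a non-empty connected induced subgraph of $G$, the $H_i$ are pairwise vertex-disjoint, and $V(G)=V(H_1)\cup\dots\cup V(H_\ell)$. Two disjoint subgraphs are adjacent if some edge of $G$ joins them. A connected partition has width $k$ if for each $i\in\{1,\dots,\ell-1\}$, each component of $G-(V(H_1)\cup\dots\cup V(H_i))$ is adjacent to at most $k$ of $H_1,\dots,H_i$. A graph has bandwidth at most $k$ if its vertices can be ordered $v_1,\dots,v_n$ with $|i-j|\le k$ for each edge $v_iv_j$. A graph is $2$-colourable with clustering $c$ if its vertices can be given one of $2$ colours so that every connected component of each colour class has at most $c$ vertices. -}

module Defs where

open import Data.Nat using (ℕ; zero; suc; _+_; _*_; _∸_; _≤_; _<_; _≤ᵇ_; ∣_-_∣; ⌈_/2⌉)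
open import Data.Bool using (Bool; true; false; not; _∧_; _∨_; if_then_else_)
open import Data.Fin using (Fin; zero; suc; toℕ; inject₁; fromℕ)
open import Data.Fin.Properties using (_≟_)
open import Data.Product using (Σ; ∃; ∃-syntax; _×_; _,_; proj₁; proj₂)
open import Data.Sum using (_⊎_)
open import Data.Empty using (⊥)
open import Relation.Nullary using (¬_; yes; no)
open import Relation.Nullary.Decidable using (⌊_⌋)
open import Relation.Binary.PropositionalEquality using (_≡_; _≢_; refl)
open import Function using (_∘_; _⇔_; _⤖_; Bijection)
open import Function.Definitions using (Injective)

countF : ∀ {n} → (Fin n → Bool) → ℕ
countF {zero}  f = 0
countF {suc n} f = (if f zero then 1 else 0) + countF (f ∘ suc)

anyF : ∀ {n} → (Fin n → Bool) → Bool
anyF {zero}  f = false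
anyF {suc n} f = f zero ∨ anyF (f ∘ suc)

record Graph : Set where
  field
    n      : ℕ
    adj    : Fin n → Fin n → Bool
    sym    : ∀ u v → adj u v ≡ adj v u
    irrefl : ∀ v → adj v v ≡ false
open Graph public

Vtx : Graph → Set
Vtx G = Fin (n G)

VSet : Graph → Set
VSet G = Vtx G → Bool

Edge : (G : Graph) → Vtx G → Vtx G → Set
Edge G u v = adj G u v ≡ true

adjSets : (G : Graph) → VSet G → VSet G → Bool
adjSets G X Y = anyF (λ x → anyF (λ y → X x ∧ Y y ∧ adj G x y))

data Walk (G : Graph) (S : VSet G) : Vtx G → Vtx G → Set where
  stop : ∀ {u} → S u ≡ true → Walk G S u u
  step : ∀ {u w v} → S u ≡ true → Edge G u w → Walk G S w v → Walk G S u v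

-- G[S] is connected (as a graph on S; S may be empty)
ConnectedSet : (G : Graph) → VSet G → Set
ConnectedSet G S = ∀ u v → S u ≡ true → S v ≡ true → Walk G S u v

Connected : Graph → Set
Connected G = (1 ≤ n G) × ConnectedSet G (λ _ → true)

IsComponentIn : (G : Graph) → VSet G → VSet G → Set
IsComponentIn G S C =
  (∃[ x ] C x ≡ true) ×
  (∀ x → C x ≡ true → S x ≡ true) ×
  ConnectedSet G C ×
  (∀ x y → C x ≡ true → S y ≡ true → Edge G x y → C y ≡ true)

record MinorModel (H G : Graph) : Set where
  field
    branch    : Vtx H → VSet G
    nonempty  : ∀ a → ∃[ x ] branch a x ≡ true
    connected : ∀ a → ConnectedSet G (branch a)
    disjoint  : ∀ a b x → a ≢ b → branch a x ≡ true → branch b x ≡ false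
    edges     : ∀ a b → Edge H a b → adjSets G (branch a) (branch b) ≡ true

_≼_ : Graph → Graph → Set
H ≼ G = MinorModel H G

private
  neq : ∀ {m} → Fin m → Fin m → Bool
  neq a b = not ⌊ a ≟ b ⌋

  neq-sym : ∀ {m} (a b : Fin m) → neq a b ≡ neq b a
  neq-sym a b with a ≟ b | b ≟ a
  ... | yes _ | yes _ = refl
  ... | no _  | no _  = refl
  ... | yes refl | no ¬p = Data.Empty.⊥-elim (¬p refl)
    where import Data.Empty
  ... | no ¬p | yes refl = Data.Empty.⊥-elim (¬p refl)
    where import Data.Empty

  neq-irr : ∀ {m} (a : Fin m) → neq a a ≡ false
  neq-irr a with a ≟ a
  ... | yes _ = refl
  ... | no ¬p = Data.Empty.⊥-elim (¬p refl)
    where import Data.Empty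

K : ℕ → Graph
K t = record { n = t ; adj = neq ; sym = neq-sym ; irrefl = neq-irr }

degree : (H : Graph) → Vtx H → ℕ
degree H v = countF (adj H v)

MaxDegreeAtMost : Graph → ℕ → Set
MaxDegreeAtMost H k = ∀ v → degree H v ≤ k

BandwidthAtMost : Graph → ℕ → Set
BandwidthAtMost H k =
  Σ (Fin (n H) ⤖ Vtx H) λ σ →
    ∀ i j → Edge H (Bijection.to σ i) (Bijection.to σ j) → ∣ toℕ i - toℕ j ∣ ≤ k

HasCycle : Graph → Set
HasCycle T =
  ∃[ k ] Σ (Fin (3 + k) → Vtx T) λ f →
    Injective _≡_ _≡_ f ×
    (∀ (i : Fin (2 + k)) → Edge T (f (inject₁ i)) (f (suc i))) ×
    Edge T (f (fromℕ (2 + k))) (f zero)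

IsTree : Graph → Set
IsTree T = Connected T × ¬ HasCycle T

record TreeDecomposition (H : Graph) (k : ℕ) : Set where
  field
    T       : Graph
    isTree  : IsTree T
    bag     : Vtx T → VSet H
    covers  : ∀ v → ∃[ x ] bag x v ≡ true
    edgesIn : ∀ u v → Edge H u v → ∃[ x ] (bag x u ≡ true × bag x v ≡ true)
    subtree : ∀ v → ConnectedSet T (λ x → bag x v)
    width   : ∀ x → countF (bag x) ≤ suc k

TreewidthAtMost : Graph → ℕ → Set
TreewidthAtMost H k = TreeDecomposition H k

record PathDecomposition (H : Graph) (k : ℕ) : Set where
  field
    m       : ℕ
    bag     : Fin m → VSet H
    covers  : ∀ v → ∃[ i ] bag i v ≡ true
    edgesIn : ∀ u v → Edge H u v → ∃[ i ] (bag i u ≡ true × bag i v ≡ true)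
    interval : ∀ v (i j l : Fin m) → toℕ i ≤ toℕ j → toℕ j ≤ toℕ l →
               bag i v ≡ true → bag l v ≡ true → bag j v ≡ true
    width   : ∀ i → countF (bag i) ≤ suc k

PathwidthAtMost : Graph → ℕ → Set
PathwidthAtMost H k = PathDecomposition H k

Clustered2Colourable : Graph → ℕ → Set
Clustered2Colourable H c =
  Σ (VSet H) λ col →
    ∀ C → (IsComponentIn H col C ⊎ IsComponentIn H (not ∘ col) C) → countF C ≤ c

Consecutive : ∀ {m} → Fin m → Fin m → Set
Consecutive a b = (suc (toℕ a) ≡ toℕ b) ⊎ (suc (toℕ b) ≡ toℕ a)

DisjointPathsAtMost : (H : Graph) → VSet H → ℕ → Set
DisjointPathsAtMost H B p =
  Σ ℕ λ m → m ≤ p ×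
  Σ (Fin m → ℕ) λ len →
  Σ (Σ (Fin m) (λ j → Fin (len j)) → Vtx H) λ f →
    Injective _≡_ _≡_ f ×
    (∀ x → B (f x) ≡ true) ×
    (∀ v → B v ≡ true → ∃[ x ] f x ≡ v) ×
    (∀ j a b → Edge H (f (j , a)) (f (j , b)) ⇔ Consecutive a b) ×
    (∀ x y → proj₁ x ≢ proj₁ y → ¬ Edge H (f x) (f y))

RedBlue : Graph → ℕ → ℕ → Set
RedBlue H r p =
  Σ (VSet H) λ red → countF red ≤ r × DisjointPathsAtMost H (not ∘ red) p

record InducedSubgraph (G : Graph) : Set where
  field
    H       : Graph
    emb     : Vtx H → Vtx G
    emb-inj : Injective _≡_ _≡_ emb
    induced : ∀ a b → adj H a b ≡ adj G (emb a) (emb b)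
open InducedSubgraph public

V[_] : ∀ {G} → InducedSubgraph G → VSet G
V[ S ] x = anyF (λ a → ⌊ emb S a ≟ x ⌋)

record ConnectedPartition (G : Graph) : Set where
  field
    ℓ         : ℕ
    part      : Fin ℓ → InducedSubgraph G
    connected : ∀ i → Connected (H (part i))
    disjoint  : ∀ i j a b → emb (part i) a ≡ emb (part j) b → i ≡ j
    covers    : ∀ x → ∃[ i ] ∃[ a ] emb (part i) a ≡ x
open ConnectedPartition public

module _ {G : Graph} (P : ConnectedPartition G) where

  -- V(H_1) ∪ … ∪ V(H_i)   (parts indexed from 0, so "up to i" means toℕ j ≤ toℕ i)
  removed : Fin (ℓ P) → VSet G
  removed i x = anyF (λ j → (toℕ j ≤ᵇ toℕ i) ∧ V[ part P j ] x)

  IsComponentAfter : Fin (ℓ P) → VSet G → Set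
  IsComponentAfter i C = IsComponentIn G (not ∘ removed i) C

  numAdjacent : Fin (ℓ P) → VSet G → ℕ
  numAdjacent i C = countF (λ j → (toℕ j ≤ᵇ toℕ i) ∧ adjSets G C V[ part P j ])

  HasWidth : ℕ → Set
  HasWidth k = ∀ (i : Fin (ℓ P)) → suc (toℕ i) < ℓ P →
               ∀ C → IsComponentAfter i C → numAdjacent i C ≤ k

  nbrsIn : Fin (ℓ P) → Vtx G → ℕ
  nbrsIn j v = countF (λ a → adj G v (emb (part P j) a))

-- Remove the parts one at a time, keeping the following invariant: the parts adjacent to a
-- component C of the remainder are pairwise adjacent.  Together with C they form a clique
-- minor, so there are at most k = t − 2 of them.  The next part S is a smallest connected
-- subset of C containing a neighbour (a "terminal") of each of these parts; this restores
-- the invariant, because S is adjacent to all of them.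
--
-- The structure of S comes from minimality.  If Q ⊆ S is connected, a breadth-first search
-- from Q splits S ∖ Q into one subtree for each neighbour of Q, and each subtree contains a
-- terminal, for otherwise it could be pruned; so Q has at most as many neighbours in S as
-- there are terminals outside Q.  With Q a vertex this bounds the degree, with Q a prefix
-- of a breadth-first ordering the bandwidth, and with Q everything before a breadth-first layer
-- the size of that layer, which is used for the clustered colouring.  Adding terminals one by one along shortest paths gives the
-- red–blue colouring.
--
-- A vertex v outside S has at most k + 1 neighbours in S: in the subtrees of S ∪ {v} rooted
-- at these neighbours, two vertices that are not needed to connect the terminals could be
-- exchanged for v.  As k + 1 ≤ 2t − 6 unless t = 4, only t = 4 needs an extra argument:
-- three neighbours of v would give a K₄ minor.
module Submission where

open import Defs
open import Data.Nat using (ℕ; _≤_; _∸_; _*_; ⌈_/2⌉)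
open import Data.Fin using (Fin; toℕ)
open import Data.Bool using (true)
open import Data.Product using (Σ; _×_)
open import Relation.Nullary using (¬_)
open import Relation.Binary.PropositionalEquality using (_≡_; _≢_)

open import Data.Nat using (zero; suc; _+_; _<_; _≤ᵇ_; z≤n; s≤s; ∣_-_∣; _≤?_; _<?_)
open import Data.Nat.Properties hiding (_≟_; _≤?_; _<?_; suc-injective)
import Data.Nat.Properties as ℕₚ
open import Data.Fin using (zero; suc; inject₁; fromℕ; fromℕ<; opposite)
open import Data.Fin.Properties using (_≟_; any?; all?; toℕ-injective; toℕ<n; toℕ-fromℕ<; toℕ-fromℕ; injective⇒≤; suc-injective; opposite-prop; opposite-involutive)
open import Data.Fin.Subset.Properties using (anySubset?)
open import Data.Bool using (Bool; false; not; _∧_; _xor_)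
import Data.Bool.Properties as Boolₚ
open import Data.Product using (∃; ∃-syntax; _,_; proj₁; proj₂)
open import Data.Sum using (_⊎_; inj₁; inj₂; [_,_]′)
open import Data.Empty using (⊥; ⊥-elim)
open import Data.Unit using (⊤)
import Data.Vec as Vec
import Data.Vec.Properties as Vecₚ
open import Relation.Nullary using (Dec; yes; no; does)
open import Relation.Nullary.Decidable using (dec-true; decidable-stable; ⌊_⌋; map′; _×-dec_; _⊎-dec_; _→-dec_; ¬?)
open import Relation.Binary.PropositionalEquality using (refl; trans; cong; subst)
import Relation.Binary.PropositionalEquality as ≡
open import Relation.Binary using (tri<; tri≈; tri>)
open import Function using (_∘_; id; _⇔_; Bijection; mk⇔; mk⤖)
open import Function.Definitions using (Injective)

-- Decidable subsets of `Fin n` and their sizes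

infix 4 _∈_ _∉_ _⊆_

_∈_ _∉_ : ∀ {n} → Fin n → (Fin n → Bool) → Set
x ∈ S = S x ≡ true
x ∉ S = ¬ (x ∈ S)

_⊆_ : ∀ {n} (S T : Fin n → Bool) → Set
S ⊆ T = ∀ x → x ∈ S → x ∈ T

full : ∀ {n} → Fin n → Bool
full _ = true

_∈?_ : ∀ {n} (x : Fin n) (S : Fin n → Bool) → Dec (x ∈ S)
x ∈? S = S x Boolₚ.≟ true

⟦_⟧ : ∀ {n} {P : Fin n → Set} → (∀ x → Dec (P x)) → Fin n → Bool
⟦ P? ⟧ x = does (P? x)

∈⁺ : ∀ {n} {P : Fin n → Set} (P? : ∀ x → Dec (P x)) x → P x → x ∈ ⟦ P? ⟧
∈⁺ P? x = dec-true (P? x)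

∈⁻ : ∀ {n} {P : Fin n → Set} (P? : ∀ x → Dec (P x)) x → x ∈ ⟦ P? ⟧ → P x
∈⁻ P? x e with yes p ← P? x = p

∉⇒≡false : ∀ {b : Bool} → ¬ (b ≡ true) → b ≡ false
∉⇒≡false {false} _ = refl
∉⇒≡false {true} h = ⊥-elim (h refl)

not⁺ : ∀ {b : Bool} → ¬ (b ≡ true) → not b ≡ true
not⁺ h = cong not (∉⇒≡false h)

not⁻ : ∀ {b : Bool} → not b ≡ true → ¬ (b ≡ true)
not⁻ {false} _ ()

∧⁺ : ∀ {a b : Bool} → a ≡ true → b ≡ true → a ∧ b ≡ true
∧⁺ refl refl = refl

∧⁻ : ∀ {a b : Bool} → a ∧ b ≡ true → a ≡ true × b ≡ true
∧⁻ {true} {true} _ = refl , refl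

⌊⌋⁺ : ∀ {P : Set} (d : Dec P) → P → ⌊ d ⌋ ≡ true
⌊⌋⁺ (yes _) _ = refl
⌊⌋⁺ (no ¬p) p = ⊥-elim (¬p p)

⌊⌋⁻ : ∀ {P : Set} (d : Dec P) → ⌊ d ⌋ ≡ true → P
⌊⌋⁻ (yes p) _ = p

≤ᵇ⁺ : ∀ {a b} → a ≤ b → (a ≤ᵇ b) ≡ true
≤ᵇ⁺ {a} {b} h with a ≤ᵇ b | ≤⇒≤ᵇ h
... | true | _ = refl

≤ᵇ⁻ : ∀ {a b} → (a ≤ᵇ b) ≡ true → a ≤ b
≤ᵇ⁻ {a} {b} e = ≤ᵇ⇒≤ a b (subst T (≡.sym e) _)
  where open import Data.Bool using (T)

anyF⁺ : ∀ {n} (f : Fin n → Bool) x → f x ≡ true → anyF f ≡ true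
anyF⁺ f zero e rewrite e = refl
anyF⁺ f (suc x) e with f zero
... | true = refl
... | false = anyF⁺ (f ∘ suc) x e

anyF⁻ : ∀ {n} (f : Fin n → Bool) → anyF f ≡ true → ∃[ x ] f x ≡ true
anyF⁻ {suc n} f e with f zero in eq
... | true = zero , eq
... | false with x , p ← anyF⁻ (f ∘ suc) e = suc x , p

enum : ∀ {n} (f : Fin n → Bool) → Fin (countF f) → Fin n
enum {suc n} f i with f zero
enum {suc n} f zero    | true = zero
enum {suc n} f (suc i) | true = suc (enum (f ∘ suc) i)
enum {suc n} f i       | false = suc (enum (f ∘ suc) i)

enum-∈ : ∀ {n} (f : Fin n → Bool) i → enum f i ∈ f
enum-∈ {suc n} f i with f zero in eq
enum-∈ {suc n} f zero    | true = eq
enum-∈ {suc n} f (suc i) | true = enum-∈ (f ∘ suc) i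
enum-∈ {suc n} f i       | false = enum-∈ (f ∘ suc) i

enum-injective : ∀ {n} (f : Fin n → Bool) {i j} → enum f i ≡ enum f j → i ≡ j
enum-injective {suc n} f {i} {j} e with f zero
enum-injective {suc n} f {zero} {zero} e | true = refl
enum-injective {suc n} f {suc i} {suc j} e | true =
  cong suc (enum-injective (f ∘ suc) (suc-injective e))
enum-injective {suc n} f {i} {j} e | false = enum-injective (f ∘ suc) (suc-injective e)

enum-surjective : ∀ {n} (f : Fin n → Bool) x → x ∈ f → ∃[ i ] enum f i ≡ x
enum-surjective {suc n} f x e with f zero in eq
enum-surjective {suc n} f zero e | true = zero , refl
enum-surjective {suc n} f (suc x) e | true
  with i , p ← enum-surjective (f ∘ suc) x e = suc i , cong suc p
enum-surjective {suc n} f zero e | false with () ← trans (≡.sym eq) e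
enum-surjective {suc n} f (suc x) e | false
  with i , p ← enum-surjective (f ∘ suc) x e = i , cong suc p

count≤ : ∀ {n k} (f : Fin n → Bool) (φ : ∀ x → x ∈ f → Fin k) →
  (∀ x y p q → φ x p ≡ φ y q → x ≡ y) → countF f ≤ k
count≤ f φ inj = injective⇒≤ {f = λ i → φ (enum f i) (enum-∈ f i)}
  (λ e → enum-injective f (inj _ _ _ _ e))

count≤count : ∀ {n m} (f : Fin n → Bool) (g : Fin m → Bool)
  (φ : ∀ x → x ∈ f → ∃[ y ] y ∈ g) →
  (∀ x y p q → proj₁ (φ x p) ≡ proj₁ (φ y q) → x ≡ y) → countF f ≤ countF g
count≤count f g φ inj = count≤ f
  (λ x p → proj₁ (enum-surjective g _ (proj₂ (φ x p))))
  (λ x y p q e → inj x y p q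
    (trans (≡.sym (proj₂ (enum-surjective g _ (proj₂ (φ x p)))))
      (trans (cong (enum g) e) (proj₂ (enum-surjective g _ (proj₂ (φ y q)))))))

count-mono : ∀ {n} (f g : Fin n → Bool) → f ⊆ g → countF f ≤ countF g
count-mono f g h = count≤count f g (λ x p → x , h x p) (λ _ _ _ _ e → e)

≤count : ∀ {m n} (f : Fin n → Bool) (e : Fin m → Fin n) →
  (∀ {i j} → e i ≡ e j → i ≡ j) → (∀ i → e i ∈ f) → m ≤ countF f
≤count f e inj e∈ = injective⇒≤ {f = λ i → proj₁ (enum-surjective f (e i) (e∈ i))}
  (λ {i} {j} q → inj (trans (≡.sym (proj₂ (enum-surjective f (e i) (e∈ i))))
    (trans (cong (enum f) q) (proj₂ (enum-surjective f (e j) (e∈ j))))))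

count-< : ∀ {n} (f g : Fin n → Bool) → f ⊆ g → ∀ y → y ∈ g → y ∉ f → countF f < countF g
count-< {n} f g f⊆g y y∈g y∉f = ≤count g e inj e∈
  where
  e : Fin (suc (countF f)) → Fin n
  e zero = y
  e (suc i) = enum f i
  inj : ∀ {i j} → e i ≡ e j → i ≡ j
  inj {zero} {zero} _ = refl
  inj {zero} {suc j} q = ⊥-elim (y∉f (subst (_∈ f) (≡.sym q) (enum-∈ f j)))
  inj {suc i} {zero} q = ⊥-elim (y∉f (subst (_∈ f) q (enum-∈ f i)))
  inj {suc i} {suc j} q = cong suc (enum-injective f q)
  e∈ : ∀ i → e i ∈ g
  e∈ zero = y∈g
  e∈ (suc i) = f⊆g _ (enum-∈ f i)

count-≤-full : ∀ {n} (f : Fin n → Bool) → countF f ≤ n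
count-≤-full f = count≤ f (λ x _ → x) (λ _ _ _ _ e → e)

-- The slot `zero` is kept for `y`; every other element goes to its position in the smaller set.
count-remove : ∀ {n} (f : Fin n → Bool) y → countF f ≤ suc (countF ⟦ (λ x → (x ∈? f) ×-dec ¬? (x ≟ y)) ⟧)
count-remove {n} f y = count≤ f φ inj
  where
  P? = λ x → (x ∈? f) ×-dec ¬? (x ≟ y)
  φ : ∀ x → x ∈ f → Fin (suc (countF ⟦ P? ⟧))
  φ x p with x ≟ y
  ... | yes _ = zero
  ... | no h = suc (proj₁ (enum-surjective ⟦ P? ⟧ x (∈⁺ P? x (p , h))))
  inj : ∀ x z p q → φ x p ≡ φ z q → x ≡ z
  inj x z p q e with x ≟ y | z ≟ y
  ... | yes refl | yes refl = refl
  ... | no h | no k = trans (≡.sym (proj₂ (enum-surjective ⟦ P? ⟧ x (∈⁺ P? x (p , h)))))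
    (trans (cong (enum ⟦ P? ⟧) (suc-injective e)) (proj₂ (enum-surjective ⟦ P? ⟧ z (∈⁺ P? z (q , k)))))

least : ∀ {P : ℕ → Set} → (∀ i → Dec (P i)) → ∀ i → P i →
  ∃[ j ] P j × (∀ l → P l → j ≤ l)
least P? i p with P? 0
... | yes p₀ = 0 , p₀ , λ _ _ → z≤n
least P? zero p | no ¬p₀ = ⊥-elim (¬p₀ p)
least P? (suc i) p | no ¬p₀ with j , pj , low ← least (P? ∘ suc) i p =
  suc j , pj , λ { zero q → ⊥-elim (¬p₀ q) ; (suc l) q → s≤s (low l q) }

greatest : ∀ {m} {P : Fin m → Set} → (∀ i → Dec (P i)) →
  (∀ i → ¬ P i) ⊎ (∃[ i ] P i × (∀ j → P j → toℕ j ≤ toℕ i))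
greatest {zero} P? = inj₁ λ ()
greatest {suc m} P? with greatest (P? ∘ suc) | P? zero
... | inj₂ (i , p , up) | _ = inj₂ (suc i , p , λ { zero _ → z≤n ; (suc j) q → s≤s (up j q) })
... | inj₁ none | yes p = inj₂ (zero , p , λ { zero _ → z≤n ; (suc j) q → ⊥-elim (none j q) })
... | inj₁ none | no ¬p = inj₁ λ { zero → ¬p ; (suc j) → none j }

-- Adjacency, walks and connected sets

neighbours : (G : Graph) → VSet G → VSet G
neighbours G Q x = anyF λ q → Q q ∧ adj G x q

module _ (G : Graph) where

  Edge-sym : ∀ {x y} → Edge G x y → Edge G y x
  Edge-sym {x} {y} e = trans (sym G y x) e

  Edge-irrefl : ∀ {x} → ¬ Edge G x x
  Edge-irrefl {x} e with () ← trans (≡.sym e) (irrefl G x)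

  Edge? : ∀ x y → Dec (Edge G x y)
  Edge? x y = adj G x y Boolₚ.≟ true

  neighbours⁺ : ∀ Q {x q} → q ∈ Q → Edge G x q → x ∈ neighbours G Q
  neighbours⁺ Q {x} {q} q∈Q e = anyF⁺ (λ q → Q q ∧ adj G x q) q (∧⁺ q∈Q e)

  neighbours⁻ : ∀ Q {x} → x ∈ neighbours G Q → ∃[ q ] (q ∈ Q × Edge G x q)
  neighbours⁻ Q {x} h with q , p ← anyF⁻ (λ q → Q q ∧ adj G x q) h = q , ∧⁻ p

  adjSets⁺ : ∀ X Y {x y} → x ∈ X → y ∈ Y → Edge G x y → adjSets G X Y ≡ true
  adjSets⁺ X Y {x} {y} p q e =
    anyF⁺ (λ x → anyF λ y → X x ∧ Y y ∧ adj G x y) x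
      (anyF⁺ (λ y → X x ∧ Y y ∧ adj G x y) y (∧⁺ p (∧⁺ q e)))

  adjSets⁻ : ∀ X Y → adjSets G X Y ≡ true → ∃[ x ] ∃[ y ] (x ∈ X × y ∈ Y × Edge G x y)
  adjSets⁻ X Y h
    with x , h₁ ← anyF⁻ (λ x → anyF λ y → X x ∧ Y y ∧ adj G x y) h
    with y , h₂ ← anyF⁻ (λ y → X x ∧ Y y ∧ adj G x y) h₁
    with p , h₃ ← ∧⁻ h₂ with q , e ← ∧⁻ h₃ = x , y , p , q , e

  adjSets-sym : ∀ X Y → adjSets G X Y ≡ true → adjSets G Y X ≡ true
  adjSets-sym X Y h with x , y , p , q , e ← adjSets⁻ X Y h = adjSets⁺ Y X q p (Edge-sym e)

  adjSets-mono : ∀ {X X′ Y Y′} → X ⊆ X′ → Y ⊆ Y′ → adjSets G X Y ≡ true → adjSets G X′ Y′ ≡ true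
  adjSets-mono {X} {X′} {Y} {Y′} f g h with x , y , p , q , e ← adjSets⁻ X Y h =
    adjSets⁺ X′ Y′ (f x p) (g y q) e

module _ {G : Graph} where

  walk-source : ∀ {S u v} → Walk G S u v → u ∈ S
  walk-source (stop p) = p
  walk-source (step p _ _) = p

  walk-target : ∀ {S u v} → Walk G S u v → v ∈ S
  walk-target (stop p) = p
  walk-target (step _ _ w) = walk-target w

  walk-trans : ∀ {S u v w} → Walk G S u v → Walk G S v w → Walk G S u w
  walk-trans (stop _) q = q
  walk-trans (step p e w) q = step p e (walk-trans w q)

  walk-snoc : ∀ {S u v w} → Walk G S u v → Edge G v w → w ∈ S → Walk G S u w
  walk-snoc p e w∈ = walk-trans p (step (walk-target p) e (stop w∈))

  walk-sym : ∀ {S u v} → Walk G S u v → Walk G S v u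
  walk-sym (stop p) = stop p
  walk-sym (step p e w) = walk-snoc (walk-sym w) (Edge-sym G e) p

  walk-mono : ∀ {S T u v} → S ⊆ T → Walk G S u v → Walk G T u v
  walk-mono h (stop p) = stop (h _ p)
  walk-mono h (step p e w) = step (h _ p) e (walk-mono h w)

  walk-preserves : ∀ {S u v} (P : Vtx G → Set) →
    (∀ x y → x ∈ S → y ∈ S → Edge G x y → P x → P y) → Walk G S u v → P u → P v
  walk-preserves P h (stop _) p = p
  walk-preserves P h (step s e w) p =
    walk-preserves P h w (h _ _ s (walk-source w) e p)

  walk-within : ∀ {S u v} X → (∀ x y → x ∈ X → y ∈ S → Edge G x y → y ∈ X) →
    u ∈ X → Walk G S u v → Walk G X u v
  walk-within X h p (stop _) = stop p
  walk-within X h p (step _ e w) = step p e (walk-within X h (h _ _ p (walk-source w) e) w)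

  walk-exit : ∀ {S u v} X → Walk G S u v → u ∈ X → v ∉ X →
    ∃[ x ] ∃[ y ] (x ∈ X × y ∉ X × x ∈ S × y ∈ S × Edge G x y)
  walk-exit X (stop _) p q = ⊥-elim (q p)
  walk-exit X (step {w = w} s e ws) p q with w ∈? X
  ... | yes w∈ = walk-exit X ws w∈ q
  ... | no w∉ = _ , w , p , w∉ , s , walk-source ws , e

  rooted⇒connected : ∀ {S} r → (∀ x → x ∈ S → Walk G S x r) → ConnectedSet G S
  rooted⇒connected r h u v p q = walk-trans (h u p) (walk-sym (h v q))

  connected-cong : ∀ {S T} → S ⊆ T → T ⊆ S → ConnectedSet G S → ConnectedSet G T
  connected-cong f g c u v p q = walk-mono f (c u v (g u p) (g v q))

  connected-singleton : ∀ r {S : VSet G} → (∀ x → x ∈ S → x ≡ r) → ConnectedSet G S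
  connected-singleton r h u v p q with h u p | h v q
  ... | refl | refl = stop p

  connected-union : ∀ {X Y Z} → ConnectedSet G X → ConnectedSet G Y →
    X ⊆ Z → Y ⊆ Z → (∀ z → z ∈ Z → z ∈ X ⊎ z ∈ Y) →
    ∀ {x y} → x ∈ X → y ∈ Y → Edge G x y → ConnectedSet G Z
  connected-union {X} {Y} {Z} cX cY fX fY split {x} {y} x∈ y∈ e = rooted⇒connected x root
    where
    root : ∀ z → z ∈ Z → Walk G Z z x
    root z p with split z p
    ... | inj₁ z∈ = walk-mono fX (cX z x z∈ x∈)
    ... | inj₂ z∈ = walk-snoc (walk-mono fY (cY z y z∈ y∈)) (Edge-sym G e) (fX x x∈)

  descend : ∀ {S} Q (rank : Vtx G → ℕ) →
    (∀ x → x ∈ S → x ∉ Q → ∃[ y ] (y ∈ S × Edge G x y × rank y < rank x)) →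
    ∀ x → x ∈ S → ∃[ q ] (q ∈ Q × Walk G S x q)
  descend {S} Q rank next x = go (suc (rank x)) x ≤-refl
    where
    go : ∀ f x → rank x < f → x ∈ S → ∃[ q ] (q ∈ Q × Walk G S x q)
    go (suc f) x (s≤s lt) p with x ∈? Q
    ... | yes x∈Q = x , x∈Q , stop p
    ... | no x∉Q with y , y∈ , e , y< ← next x p x∉Q
                 with q , q∈ , w ← go f y (<-≤-trans y< lt) y∈ = q , q∈ , step p e w

  -- Both end points descend into `Q`, which joins their descents. The rank used later is always a
  -- distance, and the next vertex a parent.
  descend-connected : ∀ {S} Q (rank : Vtx G → ℕ) → ConnectedSet G Q → Q ⊆ S →
    (∀ x → x ∈ S → x ∉ Q → ∃[ y ] (y ∈ S × Edge G x y × rank y < rank x)) → ConnectedSet G S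
  descend-connected Q rank cQ Q⊆S next u v p q
    with q₁ , q₁∈ , w₁ ← descend Q rank next u p
    with q₂ , q₂∈ , w₂ ← descend Q rank next v q =
    walk-trans w₁ (walk-trans (walk-mono Q⊆S (cQ q₁ q₂ q₁∈ q₂∈)) (walk-sym w₂))

-- Distance layers and subtrees

-- Distance to Q inside G[S]; junk outside S.
record Layering (G : Graph) (S Q : VSet G) : Set where
  field
    dist      : Vtx G → ℕ
    par       : Vtx G → Vtx G
    dist-∈    : ∀ x → x ∈ Q → dist x ≡ 0
    dist-∉    : ∀ x → x ∈ S → x ∉ Q → dist x ≢ 0
    par-∈     : ∀ x → x ∈ S → x ∉ Q → par x ∈ S
    par-edge  : ∀ x → x ∈ S → x ∉ Q → Edge G x (par x)
    par-dist  : ∀ x → x ∈ S → x ∉ Q → dist x ≡ suc (dist (par x))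
    lipschitz : ∀ x y → x ∈ S → y ∈ S → Edge G x y → dist y ≤ suc (dist x)

module _ (G : Graph) (S Q : VSet G) (Q⊆S : Q ⊆ S)
         (reach : ∀ x → x ∈ S → ∃[ q ] (q ∈ Q × Walk G S x q)) where

  private
    -- Walks of at most `i` steps to `Q`, by recursion on `i`: in this form the property is
    -- decidable and `least` can extract the distance.
    Near : ℕ → Vtx G → Set
    Near zero x = x ∈ Q
    Near (suc i) x = Near i x ⊎ ∃[ y ] (y ∈ S × Edge G x y × Near i y)

    near? : ∀ i x → Dec (Near i x)
    near? zero x = x ∈? Q
    near? (suc i) x = near? i x ⊎-dec any? λ y → (y ∈? S) ×-dec Edge? G x y ×-dec near? i y

    near : ∀ {x q} → Walk G S x q → q ∈ Q → ∃[ i ] Near i x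
    near (stop _) q∈ = 0 , q∈
    near (step _ e w) q∈ with i , h ← near w q∈ = suc i , inj₂ (_ , walk-source w , e , h)

    distance : ∀ x → x ∈ S → ∃[ i ] (Near i x × (∀ l → Near l x → i ≤ l))
    distance x p with q , q∈ , w ← reach x p with i , h ← near w q∈ = least (λ j → near? j x) i h

    d : Vtx G → ℕ
    d x with x ∈? S
    ... | yes p = proj₁ (distance x p)
    ... | no _ = 0

    d-near : ∀ x → x ∈ S → Near (d x) x
    d-near x p with x ∈? S
    ... | yes p′ = proj₁ (proj₂ (distance x p′))
    ... | no h = ⊥-elim (h p)

    d-least : ∀ x i → Near i x → d x ≤ i
    d-least x i h with x ∈? S
    ... | yes p′ = proj₂ (proj₂ (distance x p′)) i h
    ... | no _ = z≤n

    parent : ∀ x → x ∈ S → x ∉ Q → ∃[ y ] (y ∈ S × Edge G x y × d x ≡ suc (d y))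
    parent x p x∉ with d x in eq | d-near x p
    ... | zero | h = ⊥-elim (x∉ h)
    ... | suc i | inj₁ h = ⊥-elim (1+n≰n (subst (_≤ i) eq (d-least x i h)))
    ... | suc i | inj₂ (y , y∈ , e , h) = y , y∈ , e , cong suc (≤-antisym low (d-least y i h))
      where
      low : i ≤ d y
      -- A walk from `y` extends to one from `x`, so `x` is at most one step farther from `Q` than
      -- `y`.
      low = ≤-pred (subst (_≤ suc (d y)) eq (d-least x (suc (d y)) (inj₂ (y , y∈ , e , d-near y y∈))))

    -- Outside `S` and inside `Q` the value `x` is a dummy, for which the specification is vacuous.
    up : ∀ x → Dec (x ∈ S) → Dec (x ∈ Q) →
      ∃[ y ] (x ∈ S → x ∉ Q → y ∈ S × Edge G x y × d x ≡ suc (d y))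
    up x (yes p) (no q) = proj₁ (parent x p q) , λ _ _ → proj₂ (parent x p q)
    up x (yes _) (yes q) = x , λ _ q′ → ⊥-elim (q′ q)
    up x (no p) _ = x , λ p′ _ → ⊥-elim (p p′)

    up-spec : ∀ x → x ∈ S → x ∉ Q → _
    up-spec x = proj₂ (up x (x ∈? S) (x ∈? Q))

  abstract
    layering : Layering G S Q
    layering = record
      { dist = d
      ; par = λ x → proj₁ (up x (x ∈? S) (x ∈? Q))
      ; dist-∈ = λ x q → n≤0⇒n≡0 (d-least x 0 q)
      ; dist-∉ = λ x p q e → q (subst (λ i → Near i x) e (d-near x p))
      ; par-∈ = λ x p q → proj₁ (up-spec x p q)
      ; par-edge = λ x p q → proj₁ (proj₂ (up-spec x p q))
      ; par-dist = λ x p q → proj₂ (proj₂ (up-spec x p q))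
      ; lipschitz = λ x y p q e → d-least y _ (inj₂ (x , p , Edge-sym G e , d-near x p))
      }

layering-connected : ∀ {G} S Q → Q ⊆ S → (∃[ q ] q ∈ Q) → ConnectedSet G S → Layering G S Q
layering-connected {G} S Q Q⊆S (q , q∈) c = layering G S Q Q⊆S λ x p → q , q∈ , c x q p (Q⊆S q q∈)

-- The tree edges x — par x cut S ∖ Q into one subtree for each neighbour of Q;
-- owner x is the root of the subtree of x.
module Subtrees {G : Graph} {S Q : VSet G} (L : Layering G S Q)
                (Q⊆S : Q ⊆ S) (cQ : ConnectedSet G Q) where
  open Layering L

  private
    -- The number is the distance still to go. From a vertex outside `Q` the climb stops at distance
    -- 1, hence at a neighbour of `Q`.
    climb : ℕ → Vtx G → Vtx G
    climb (suc (suc d)) x = climb (suc d) (par x)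
    climb _ x = x

  owner : Vtx G → Vtx G
  owner x = climb (dist x) x

  owner-par : ∀ x → x ∈ S → x ∉ Q → par x ∉ Q → owner x ≡ owner (par x)
  owner-par x p q pq rewrite par-dist x p q with dist (par x) in eq
  ... | zero = ⊥-elim (dist-∉ (par x) (par-∈ x p q) pq eq)
  ... | suc d = refl

  owner-top : ∀ x → x ∈ S → x ∉ Q → par x ∈ Q → owner x ≡ x
  owner-top x p q pq rewrite par-dist x p q | dist-∈ (par x) pq = refl

  -- An edge to `Q` makes the distance at most 1, so the climb stops at once.
  owner-neighbour : ∀ x → x ∈ S → x ∉ Q → x ∈ neighbours G Q → owner x ≡ x
  owner-neighbour x p q h with y , y∈ , e ← neighbours⁻ G Q h
    with dist x | lipschitz y x (Q⊆S y y∈) p (Edge-sym G e)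
  ... | zero | _ = refl
  ... | suc zero | _ = refl
  ... | suc (suc d) | le rewrite dist-∈ y y∈ with () ← ≤-pred le

  private
    par-< : ∀ x → x ∈ S → x ∉ Q → dist (par x) < dist x
    par-< x p q = ≤-reflexive (≡.sym (par-dist x p q))

  owner-spec : ∀ x → x ∈ S → x ∉ Q → owner x ∈ S × owner x ∉ Q × owner x ∈ neighbours G Q
  owner-spec x = go (suc (dist x)) x ≤-refl
    where
    go : ∀ f x → dist x < f → x ∈ S → x ∉ Q →
      owner x ∈ S × owner x ∉ Q × owner x ∈ neighbours G Q
    go (suc f) x (s≤s lt) p q with par x ∈? Q
    ... | yes pq rewrite owner-top x p q pq = p , q , neighbours⁺ G Q pq (par-edge x p q)
    ... | no pq rewrite owner-par x p q pq =
      go f (par x) (<-≤-trans (par-< x p q) lt) (par-∈ x p q) pq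

  inSubtree? : ∀ w x → Dec (x ∈ S × x ∉ Q × owner x ≡ w)
  inSubtree? w x = (x ∈? S) ×-dec ¬? (x ∈? Q) ×-dec (owner x ≟ w)

  -- Inside the subtree, parents lead to `w`. If `w` is not in its own subtree then that subtree is
  -- empty, since every owner owns itself.
  subtree-connected : ∀ w → ConnectedSet G ⟦ inSubtree? w ⟧
  subtree-connected w with inSubtree? w w
  ... | no w∉ = λ u v p _ → ⊥-elim (empty u (∈⁻ (inSubtree? w) u p))
    where
    empty : ∀ u → ¬ (u ∈ S × u ∉ Q × owner u ≡ w)
    empty u (p , q , refl) with a , b , c ← owner-spec u p q =
      w∉ (a , b , owner-neighbour (owner u) a b c)
  ... | yes w∈ = descend-connected R dist (connected-singleton w (∈⁻ (_≟ w))) R⊆ next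
    where
    R = ⟦ (_≟ w) ⟧
    R⊆ : R ⊆ ⟦ inSubtree? w ⟧
    R⊆ x h with refl ← ∈⁻ (_≟ w) x h = ∈⁺ (inSubtree? w) x w∈
    next : ∀ x → x ∈ ⟦ inSubtree? w ⟧ → x ∉ R →
      ∃[ y ] (y ∈ ⟦ inSubtree? w ⟧ × Edge G x y × dist y < dist x)
    next x h x∉ with p , q , o ← ∈⁻ (inSubtree? w) x h with par x ∈? Q
    ... | yes pq = ⊥-elim (x∉ (∈⁺ (_≟ w) x (trans (≡.sym (owner-top x p q pq)) o)))
    ... | no pq = par x ,
      ∈⁺ (inSubtree? w) (par x) (par-∈ x p q , pq , trans (≡.sym (owner-par x p q pq)) o) ,
      par-edge x p q , par-< x p q

  kept? : (Bad : VSet G) → ∀ x → Dec (x ∈ S × (x ∈ Q ⊎ owner x ∉ Bad))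
  kept? Bad x = (x ∈? S) ×-dec ((x ∈? Q) ⊎-dec ¬? (owner x ∈? Bad))

  -- Only whole subtrees are cut off: the parent of a kept vertex outside `Q` lies in `Q` or has the
  -- same owner, so it is kept too.
  prune-connected : ∀ Bad → ConnectedSet G ⟦ kept? Bad ⟧
  prune-connected Bad = descend-connected Q dist cQ
    (λ x q → ∈⁺ (kept? Bad) x (Q⊆S x q , inj₁ q)) next
    where
    next : ∀ x → x ∈ ⟦ kept? Bad ⟧ → x ∉ Q →
      ∃[ y ] (y ∈ ⟦ kept? Bad ⟧ × Edge G x y × dist y < dist x)
    next x h q with ∈⁻ (kept? Bad) x h
    ... | p , inj₁ x∈Q = ⊥-elim (q x∈Q)
    ... | p , inj₂ o = par x , ∈⁺ (kept? Bad) (par x) (par-∈ x p q , good) , par-edge x p q , par-< x p q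
      where
      good : par x ∈ Q ⊎ owner (par x) ∉ Bad
      good with par x ∈? Q
      ... | yes pq = inj₁ pq
      ... | no pq = inj₂ (subst (_∉ Bad) (owner-par x p q pq) o)

-- Minimal connected sets containing given terminals

Spans : (G : Graph) {k : ℕ} (a : Fin k → Vtx G) → VSet G → Set
Spans G a X = ConnectedSet G X × (∀ i → a i ∈ X)

Minimal : (G : Graph) {k : ℕ} (a : Fin k → Vtx G) → Set
Minimal G a = ∀ X → Spans G a X → ∀ x → x ∈ X

-- A subtree without terminals could be pruned, so the subtrees of the
-- neighbours of Q contain distinct terminals.
boundary≤terminals : ∀ {G k} (a : Fin k → Vtx G) → ConnectedSet G full → Minimal G a →
  ∀ Q → (∃[ q ] q ∈ Q) → ConnectedSet G Q →
  ∀ W → (∀ w → w ∈ W → w ∉ Q × w ∈ neighbours G Q) →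
  countF W ≤ countF (λ i → not (Q (a i)))
boundary≤terminals {G} {k} a c min Q nonempty cQ W hW =
  -- The owner of the terminal chosen for `w` is `w` again, so the choice is injective.
  count≤count W (λ i → not (Q (a i))) (λ w p → proj₁ (terminal w p) , not⁺ (proj₁ (proj₂ (terminal w p))))
    (λ w w′ p p′ e → trans (≡.sym (proj₂ (proj₂ (terminal w p))))
      (trans (cong (owner ∘ a) e) (proj₂ (proj₂ (terminal w′ p′)))))
  where
  open Subtrees (layering-connected full Q (λ _ _ → refl) nonempty c) (λ _ _ → refl) cQ
  terminal : ∀ w → w ∈ W → ∃[ i ] (a i ∉ Q × owner (a i) ≡ w)
  terminal w p with any? (λ i → ¬? (a i ∈? Q) ×-dec (owner (a i) ≟ w))
  ... | yes t = t
  ... | no none = ⊥-elim (lost (min _ (prune-connected ⟦ (_≟ w) ⟧ , keep) w))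
    where
    K? = kept? ⟦ (_≟ w) ⟧
    keep : ∀ i → a i ∈ ⟦ K? ⟧
    keep i = ∈⁺ K? (a i) (refl , side (a i ∈? Q))
      where
      side : Dec (a i ∈ Q) → a i ∈ Q ⊎ owner (a i) ∉ ⟦ (_≟ w) ⟧
      side (yes q) = inj₁ q
      side (no q) = inj₂ λ h → none (i , q , ∈⁻ (_≟ w) (owner (a i)) h)
    lost : w ∈ ⟦ K? ⟧ → ⊥
    lost h with ∈⁻ K? w h
    ... | _ , inj₁ q = proj₁ (hW w p) q
    ... | _ , inj₂ o = o (∈⁺ (_≟ w) (owner w) (owner-neighbour w refl (proj₁ (hW w p)) (proj₂ (hW w p))))

-- Breadth-first search

-- A breadth-first search of G[S] from r that has visited m vertices, listed with the
-- most recent one first.  By window, everything visited after u and not later than a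
-- neighbour w of u was discovered from u or from a vertex before u.
record BFS (G : Graph) (S : VSet G) (r : Vtx G) (m : ℕ) : Set where
  field
    σ         : Fin m → Vtx G
    injective : ∀ {i j} → σ i ≡ σ j → i ≡ j
    σ-∈       : ∀ i → σ i ∈ S
    root      : ∃[ i ] σ i ≡ r
    older     : ∀ i → σ i ≡ r ⊎ ∃[ j ] (toℕ i < toℕ j × Edge G (σ i) (σ j))
    frontier  : ∀ y u → y ∈ S → (∀ i → σ i ≢ y) → Edge G y (σ u) →
                ∀ x → toℕ x < toℕ u → ∃[ p ] (toℕ u ≤ toℕ p × Edge G (σ x) (σ p))
    window    : ∀ w u → Edge G (σ w) (σ u) → ∀ x → toℕ w ≤ toℕ x → toℕ x < toℕ u →
                ∃[ p ] (toℕ u ≤ toℕ p × Edge G (σ x) (σ p))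

  Closed : Set
  Closed = ∀ i y → y ∈ S → Edge G y (σ i) → ∃[ j ] σ j ≡ y

module _ (G : Graph) (S : VSet G) (r : Vtx G) (r∈S : r ∈ S) where

  private
    start : BFS G S r 1
    start = record
      { σ = λ _ → r
      ; injective = λ { {zero} {zero} _ → refl }
      ; σ-∈ = λ _ → r∈S
      ; root = zero , refl
      ; older = λ _ → inj₁ refl
      ; frontier = λ { _ zero _ _ _ zero () }
      ; window = λ { _ zero _ zero _ () }
      }

    module Extend {m} (B : BFS G S r m) where
      open BFS B

      Fresh : Fin m → Vtx G → Set
      Fresh c y = y ∈ S × (∀ i → σ i ≢ y) × Edge G y (σ c)

      fresh? : ∀ c y → Dec (Fresh c y)
      fresh? c y = (y ∈? S) ×-dec all? (λ i → ¬? (σ i ≟ y)) ×-dec Edge? G y (σ c)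

      -- Indices grow with age, so the greatest admissible `c` is the oldest vertex that still has
      -- an unvisited neighbour: the head of the queue.
      extend : ∀ c y → Fresh c y → (∀ c′ → ∃[ y ] Fresh c′ y → toℕ c′ ≤ toℕ c) →
        BFS G S r (suc m)
      extend c y (y∈S , new , e) latest = record
        { σ = σ′
        ; injective = inj
        ; σ-∈ = λ { zero → y∈S ; (suc i) → σ-∈ i }
        ; root = suc (proj₁ root) , proj₂ root
        ; older = old
        ; frontier = front
        ; window = wind
        }
        where
        σ′ : Fin (suc m) → Vtx G
        σ′ zero = y
        σ′ (suc i) = σ i

        inj : ∀ {i j} → σ′ i ≡ σ′ j → i ≡ j
        inj {zero} {zero} _ = refl
        inj {zero} {suc j} q = ⊥-elim (new j (≡.sym q))
        inj {suc i} {zero} q = ⊥-elim (new i q)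
        inj {suc i} {suc j} q = cong suc (injective q)

        old : ∀ i → σ′ i ≡ r ⊎ ∃[ j ] (toℕ i < toℕ j × Edge G (σ′ i) (σ′ j))
        old zero = inj₂ (suc c , s≤s z≤n , e)
        old (suc i) with older i
        ... | inj₁ q = inj₁ q
        ... | inj₂ (j , lt , e′) = inj₂ (suc j , s≤s lt , e′)

        front : ∀ z u → z ∈ S → (∀ i → σ′ i ≢ z) → Edge G z (σ′ u) →
          ∀ x → toℕ x < toℕ u → ∃[ p ] (toℕ u ≤ toℕ p × Edge G (σ′ x) (σ′ p))
        front z zero _ _ _ _ ()
        -- `u` still has the unvisited neighbour `z`, so it was a candidate for `c`; hence `c`, from
        -- which `y` was discovered, is at least as old as `u`.
        front z (suc u) z∈ new′ e′ zero _ =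
          suc c , s≤s (latest u (z , z∈ , (λ i → new′ (suc i)) , e′)) , e
        front z (suc u) z∈ new′ e′ (suc x) (s≤s lt)
          with p , le , e″ ← frontier z u z∈ (λ i → new′ (suc i)) e′ x lt = suc p , s≤s le , e″

        wind : ∀ w u → Edge G (σ′ w) (σ′ u) → ∀ x → toℕ w ≤ toℕ x → toℕ x < toℕ u →
          ∃[ p ] (toℕ u ≤ toℕ p × Edge G (σ′ x) (σ′ p))
        wind zero (suc u) e′ zero _ _ = suc u , ≤-refl , e′
        -- Before this step `y` was an unvisited neighbour of `u`, so the old `frontier` applies to
        -- `x`.
        wind zero (suc u) e′ (suc x) _ (s≤s lt)
          with p , le , e″ ← frontier y u y∈S new e′ x lt = suc p , s≤s le , e″
        wind (suc w) (suc u) e′ (suc x) (s≤s le) (s≤s lt)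
          with p , le′ , e″ ← window w u e′ x le lt = suc p , s≤s le′ , e″

    search : ∀ fuel {m} → BFS G S r m → n G < fuel + m → ∃[ m ] Σ (BFS G S r m) BFS.Closed
    -- The visited vertices are distinct, so there are never more than `n G` of them and the fuel
    -- lasts.
    search zero {m} B lt = ⊥-elim (<⇒≱ lt (injective⇒≤ {f = BFS.σ B} (BFS.injective B)))
    search (suc fuel) {m} B lt with greatest (λ c → any? (Extend.fresh? B c))
    ... | inj₁ none = m , B , closed
      where
      open BFS B
      closed : Closed
      closed i y y∈ e with any? (λ j → σ j ≟ y)
      ... | yes q = q
      ... | no new = ⊥-elim (none i (y , y∈ , (λ j q → new (j , q)) , e))
    ... | inj₂ (c , (y , f) , latest) =
      search fuel (Extend.extend B c y f latest) (subst (n G <_) (≡.sym (+-suc fuel m)) lt)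

  abstract
    bfs : ∃[ m ] Σ (BFS G S r m) BFS.Closed
    bfs = search (n G) start (≤-reflexive (+-comm 1 (n G)))

module _ {G : Graph} {S : VSet G} {r : Vtx G} {m : ℕ} (B : BFS G S r m) where
  open BFS B

  -- Following `older` only increases the index until the root is reached, and `X` is closed in that
  -- direction.
  prefix-walk : ∀ X → (∀ i j → toℕ i ≤ toℕ j → σ i ∈ X → σ j ∈ X) →
    ∀ i → σ i ∈ X → Walk G X (σ i) r
  prefix-walk X up i = go (suc (m ∸ toℕ i)) i ≤-refl
    where
    go : ∀ f i → m ∸ toℕ i < f → σ i ∈ X → Walk G X (σ i) r
    go (suc f) i (s≤s le) p with older i
    ... | inj₁ q rewrite q = stop p
    ... | inj₂ (j , lt , e) = step p e
      (go f j (<-≤-trans (∸-monoʳ-< lt (<⇒≤ (toℕ<n j))) le) (up i j (<⇒≤ lt) p))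

  bfs-complete : Closed → ∀ {x} → Walk G S r x → ∃[ i ] σ i ≡ x
  bfs-complete closed w = walk-preserves (λ x → ∃[ i ] σ i ≡ x)
    (λ { _ y _ y∈ e (i , refl) → closed i y y∈ (Edge-sym G e) }) w root

-- Components and smallest connected sets

walk? : ∀ G S u v → Dec (Walk G S u v)
walk? G S u v with u ∈? S
... | no u∉ = no λ w → u∉ (walk-source w)
... | yes u∈ with _ , B , closed ← bfs G S u u∈ with any? (λ i → BFS.σ B i ≟ v)
... | yes (i , refl) = yes (walk-sym (prefix-walk B S (λ _ j _ _ → BFS.σ-∈ B j) i (BFS.σ-∈ B i)))
... | no h = no λ w → h (bfs-complete B closed w)

abstract
  component : ∀ G → VSet G → Vtx G → VSet G
  component G S u = ⟦ walk? G S u ⟧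

  component⁺ : ∀ G S u {x} → Walk G S u x → x ∈ component G S u
  component⁺ G S u = ∈⁺ (walk? G S u) _

  component⁻ : ∀ G S u {x} → x ∈ component G S u → Walk G S u x
  component⁻ G S u = ∈⁻ (walk? G S u) _

module _ (G : Graph) (S : VSet G) (u : Vtx G) where

  component-closed : ∀ x y → x ∈ component G S u → y ∈ S → Edge G x y → y ∈ component G S u
  component-closed x y p q e = component⁺ G S u (walk-snoc (component⁻ G S u p) e q)

  component-connected : ConnectedSet G (component G S u)
  component-connected = rooted⇒connected u λ x p → walk-sym
    (walk-within _ component-closed (component⁺ G S u (stop (walk-source (component⁻ G S u p)))) (component⁻ G S u p))

connected? : ∀ G S → Dec (ConnectedSet G S)
connected? G S = map′ (λ h u v p q → h u v (p , q)) (λ h u v (p , q) → h u v p q)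
  (all? λ u → all? λ v → ((u ∈? S) ×-dec (v ∈? S)) →-dec walk? G S u v)

SpansIn : (G : Graph) (C : VSet G) {k : ℕ} (a : Fin k → Vtx G) → VSet G → Set
SpansIn G C a X = X ⊆ C × Spans G a X

module _ (G : Graph) (C : VSet G) {k : ℕ} (a : Fin k → Vtx G) where

  private
    smaller? : ∀ c X → Dec (SpansIn G C a X × countF X < c)
    smaller? c X = (all? (λ x → (x ∈? X) →-dec (x ∈? C)) ×-dec
      connected? G X ×-dec all? (λ i → a i ∈? X)) ×-dec (countF X <? c)

    -- `anySubset?` ranges over vectors, and a tabulated set agrees with the original one only
    -- pointwise.
    smaller-cong : ∀ c {X Y} → X ⊆ Y → Y ⊆ X →
      SpansIn G C a X × countF X < c → SpansIn G C a Y × countF Y < c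
    smaller-cong c {X} {Y} f g ((s , conn , t) , lt) =
      ((λ x p → s x (g x p)) , connected-cong f g conn , λ i → f (a i) (t i)) ,
      ≤-<-trans (count-mono Y X g) lt

    descent : ∀ fuel X → countF X < fuel → SpansIn G C a X →
      ∃[ Y ] (SpansIn G C a Y × (∀ Z → SpansIn G C a Z → countF Y ≤ countF Z))
    descent (suc fuel) X (s≤s lt) spans
      with anySubset? (λ s → smaller? (countF X) (Vec.lookup s))
    ... | yes (s , better , lt′) = descent fuel (Vec.lookup s) (<-≤-trans lt′ lt) better
    ... | no none = X , spans , λ Z z → ≮⇒≥ λ lt′ → none (Vec.tabulate Z ,
      smaller-cong (countF X)
        (λ x p → trans (Vecₚ.lookup∘tabulate Z x) p)
        (λ x p → trans (≡.sym (Vecₚ.lookup∘tabulate Z x)) p) (z , lt′))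

  abstract
    -- The size is minimised, not just inclusion: the exchange argument for vertices outside the set
    -- compares sizes.
    steiner : ConnectedSet G C → (∀ i → a i ∈ C) →
      ∃[ Y ] (SpansIn G C a Y × (∀ Z → SpansIn G C a Z → countF Y ≤ countF Z))
    steiner c a∈ = descent (suc (countF C)) C ≤-refl ((λ _ p → p) , c , a∈)

-- Degree, bandwidth, pathwidth and treewidth

degree≤terminals : ∀ {H k} (a : Fin k → Vtx H) → ConnectedSet H full → Minimal H a → MaxDegreeAtMost H k
degree≤terminals {H} {k} a c min v =
  ≤-trans (boundary≤terminals a c min Q (v , v∈Q) (connected-singleton v (∈⁻ (_≟ v))) (adj H v) outside)
    (count-≤-full _)
  where
  Q = ⟦ (_≟ v) ⟧
  v∈Q = ∈⁺ (_≟ v) v refl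
  outside : ∀ w → w ∈ adj H v → w ∉ Q × w ∈ neighbours H Q
  outside w e = (λ q → Edge-irrefl H (subst (Edge H v) (∈⁻ (_≟ v) w q) e)) ,
    neighbours⁺ H Q v∈Q (Edge-sym H e)

∣-∣≤ : ∀ {i j b} → i ≤ j → j ∸ i ≤ b → ∣ i - j ∣ ≤ b
∣-∣≤ {b = b} le h = subst (_≤ b) (≡.sym (m≤n⇒∣m-n∣≡n∸m le)) h

module _ {H : Graph} {k : ℕ} (a : Fin (suc k) → Vtx H)
         (c : ConnectedSet H full) (min : Minimal H a) where

  private
    module _ {m} (B : BFS H full (a zero) m) (closed : BFS.Closed B) where
      open BFS B

      visited : ∀ x → ∃[ i ] σ i ≡ x
      visited x = bfs-complete B closed (c (a zero) x refl refl)

      -- Let `Q` be everything visited up to `σ j`. By `window` the edge makes each of the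
      -- `toℕ j ∸ toℕ i` vertices visited after `σ j` and up to `σ i` a neighbour of `Q`. The root
      -- is a terminal in `Q`, which leaves at most `k` outside.
      gap : ∀ i j → toℕ i ≤ toℕ j → Edge H (σ i) (σ j) → toℕ j ∸ toℕ i ≤ k
      gap i j i≤j e = ≤-trans lower (≤-trans
        (boundary≤terminals a c min ⟦ Q? ⟧ (σ j , ∈⁺ Q? (σ j) (j , ≤-refl , refl)) Q-connected ⟦ W? ⟧ outside)
        upper)
        where
        Q? = λ x → any? λ p → (toℕ j ≤? toℕ p) ×-dec (σ p ≟ x)
        W? = λ x → any? λ p → (toℕ i ≤? toℕ p) ×-dec (toℕ p <? toℕ j) ×-dec (σ p ≟ x)

        Q-walk : ∀ x → x ∈ ⟦ Q? ⟧ → Walk H ⟦ Q? ⟧ x (a zero)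
        Q-walk x h with p , le , refl ← ∈⁻ Q? x h = prefix-walk B ⟦ Q? ⟧ up p h
          where
          up : ∀ p q → toℕ p ≤ toℕ q → σ p ∈ ⟦ Q? ⟧ → σ q ∈ ⟦ Q? ⟧
          up p q p≤q h with p′ , le′ , eq ← ∈⁻ Q? (σ p) h with refl ← injective eq =
            ∈⁺ Q? (σ q) (q , ≤-trans le′ p≤q , refl)

        Q-connected : ConnectedSet H ⟦ Q? ⟧
        Q-connected = rooted⇒connected (a zero) Q-walk

        root∈Q : a zero ∈ ⟦ Q? ⟧
        root∈Q = walk-target (Q-walk (σ j) (∈⁺ Q? (σ j) (j , ≤-refl , refl)))

        outside : ∀ w → w ∈ ⟦ W? ⟧ → w ∉ ⟦ Q? ⟧ × w ∈ neighbours H ⟦ Q? ⟧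
        outside w h with x , i≤x , x<j , refl ← ∈⁻ W? w h
          with p , j≤p , e′ ← window i j e x i≤x x<j = notin ,
            neighbours⁺ H ⟦ Q? ⟧ (∈⁺ Q? (σ p) (p , j≤p , refl)) e′
          where
          notin : σ x ∉ ⟦ Q? ⟧
          notin q with p , j≤p , eq ← ∈⁻ Q? (σ x) q with refl ← injective eq = <⇒≱ x<j j≤p

        upper : countF (λ l → not (⟦ Q? ⟧ (a l))) ≤ k
        upper = count≤ _ φ φ-inj
          where
          φ : ∀ l → not (⟦ Q? ⟧ (a l)) ≡ true → Fin k
          φ zero h = ⊥-elim (not⁻ h root∈Q)
          φ (suc l) h = l
          φ-inj : ∀ x y p q → φ x p ≡ φ y q → x ≡ y
          φ-inj zero _ h _ _ = ⊥-elim (not⁻ h root∈Q)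
          φ-inj (suc _) zero _ h _ = ⊥-elim (not⁻ h root∈Q)
          φ-inj (suc x) (suc y) _ _ eq = cong suc eq

        bound : (t : Fin (toℕ j ∸ toℕ i)) → toℕ i + toℕ t < toℕ j
        bound t = subst (toℕ i + toℕ t <_) (m+[n∸m]≡n i≤j) (+-monoʳ-< (toℕ i) (toℕ<n t))

        at : Fin (toℕ j ∸ toℕ i) → Fin m
        at t = fromℕ< (<-trans (bound t) (toℕ<n j))

        at-toℕ : ∀ t → toℕ (at t) ≡ toℕ i + toℕ t
        at-toℕ t = toℕ-fromℕ< _

        lower : toℕ j ∸ toℕ i ≤ countF ⟦ W? ⟧
        lower = ≤count ⟦ W? ⟧ (σ ∘ at)
          (λ {s} {t} q → toℕ-injective (+-cancelˡ-≡ (toℕ i) (toℕ s) (toℕ t)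
            (trans (≡.sym (at-toℕ s)) (trans (cong toℕ (injective q)) (at-toℕ t)))))
          (λ t → ∈⁺ W? (σ (at t)) (at t ,
            subst (toℕ i ≤_) (≡.sym (at-toℕ t)) (m≤m+n (toℕ i) (toℕ t)) ,
            subst (_< toℕ j) (≡.sym (at-toℕ t)) (bound t) , refl))

      size : m ≡ n H
      size = ≤-antisym (injective⇒≤ {f = σ} injective)
        (injective⇒≤ {f = λ x → proj₁ (visited x)}
          (λ {x} {y} q → trans (≡.sym (proj₂ (visited x))) (trans (cong σ q) (proj₂ (visited y)))))

  bandwidth<terminals : BandwidthAtMost H k
  bandwidth<terminals with m , B , closed ← bfs H full (a zero) refl with refl ← size B closed =
    mk⤖ (injective , λ x → proj₁ (visited B closed x) , λ { refl → proj₂ (visited B closed x) }) , close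
    where
    open BFS B
    close : ∀ i j → Edge H (σ i) (σ j) → ∣ toℕ i - toℕ j ∣ ≤ k
    close i j e with ≤-total (toℕ i) (toℕ j)
    ... | inj₁ le = ∣-∣≤ le (gap B closed i j le e)
    ... | inj₂ le = subst (_≤ k) (∣-∣-comm (toℕ j) (toℕ i)) (∣-∣≤ le (gap B closed j i le (Edge-sym H e)))

-- The bags are windows of `suc b` consecutive positions, and an edge lies in the window that starts
-- at its earlier end.
bandwidth⇒pathwidth : ∀ {H b} → BandwidthAtMost H b → PathwidthAtMost H b
bandwidth⇒pathwidth {H} {b} (σ , close) = record
  { m = n H
  ; bag = λ i → ⟦ bag? i ⟧
  ; covers = λ v → pos v , ∈⁺ (bag? (pos v)) v (≤-refl , m≤m+n _ b)
  ; edgesIn = edgesIn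
  ; interval = λ v i j l i≤j j≤l p q → ∈⁺ (bag? j) v
      ( ≤-trans j≤l (proj₁ (∈⁻ (bag? l) v q))
      , ≤-trans (proj₂ (∈⁻ (bag? i) v p)) (+-monoˡ-≤ b i≤j))
  ; width = width
  }
  where
  pos : Vtx H → Fin (n H)
  pos v = proj₁ (Bijection.surjective σ v)

  pos-eq : ∀ v → Bijection.to σ (pos v) ≡ v
  pos-eq v = proj₂ (Bijection.surjective σ v) refl

  bag? : (i : Fin (n H)) (v : Vtx H) → Dec (toℕ i ≤ toℕ (pos v) × toℕ (pos v) ≤ toℕ i + b)
  bag? i v = (toℕ i ≤? toℕ (pos v)) ×-dec (toℕ (pos v) ≤? toℕ i + b)

  near : ∀ u v → Edge H u v → toℕ (pos u) ≤ toℕ (pos v) → toℕ (pos v) ≤ toℕ (pos u) + b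
  near u v e le = ≤-trans (≤-reflexive (≡.sym (m+[n∸m]≡n le)))
    (+-monoʳ-≤ (toℕ (pos u)) (subst (_≤ b) (m≤n⇒∣m-n∣≡n∸m le)
      (close (pos u) (pos v) (subst₂ (Edge H) (≡.sym (pos-eq u)) (≡.sym (pos-eq v)) e))))
    where open ≡ using (subst₂)

  edgesIn : ∀ u v → Edge H u v → ∃[ i ] (u ∈ ⟦ bag? i ⟧ × v ∈ ⟦ bag? i ⟧)
  edgesIn u v e with ≤-total (toℕ (pos u)) (toℕ (pos v))
  ... | inj₁ le = pos u , ∈⁺ (bag? (pos u)) u (≤-refl , m≤m+n _ b) , ∈⁺ (bag? (pos u)) v (le , near u v e le)
  ... | inj₂ le = pos v , ∈⁺ (bag? (pos v)) u (le , near v u (Edge-sym H e) le) ,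
    ∈⁺ (bag? (pos v)) v (≤-refl , m≤m+n _ b)

  width : ∀ i → countF ⟦ bag? i ⟧ ≤ suc b
  width i = count≤ ⟦ bag? i ⟧ φ φ-inj
    where
    offset< : ∀ v → v ∈ ⟦ bag? i ⟧ → toℕ (pos v) ∸ toℕ i < suc b
    offset< v h with _ , le ← ∈⁻ (bag? i) v h =
      s≤s (≤-trans (∸-monoˡ-≤ (toℕ i) le) (≤-reflexive (m+n∸m≡n (toℕ i) b)))
    φ : ∀ v → v ∈ ⟦ bag? i ⟧ → Fin (suc b)
    φ v h = fromℕ< (offset< v h)
    φ-inj : ∀ x y p q → φ x p ≡ φ y q → x ≡ y
    φ-inj x y p q eq = trans (≡.sym (pos-eq x)) (trans (cong (Bijection.to σ) (toℕ-injective
      (∸-cancelʳ-≡ (proj₁ (∈⁻ (bag? i) x p)) (proj₁ (∈⁻ (bag? i) y q))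
        (trans (≡.sym (toℕ-fromℕ< (offset< x p))) (trans (cong toℕ eq) (toℕ-fromℕ< (offset< y q)))))))
      (pos-eq y))

consecutive? : ∀ {m} (i j : Fin m) → Dec (Consecutive i j)
consecutive? i j = (suc (toℕ i) ℕₚ.≟ toℕ j) ⊎-dec (suc (toℕ j) ℕₚ.≟ toℕ i)

pathGraph : ℕ → Graph
pathGraph m = record
  { n = m
  ; adj = λ i → ⟦ consecutive? i ⟧
  ; sym = λ i j → Boolₚ.∨-comm (does (suc (toℕ i) ℕₚ.≟ toℕ j)) _
  ; irrefl = λ i → ∉⇒≡false λ h → [ 1+n≢n , 1+n≢n ]′ (∈⁻ (consecutive? i) i h)
  }

interval-connected : ∀ {m} (X : Fin m → Bool) →
  (∀ i j l → toℕ i ≤ toℕ j → toℕ j ≤ toℕ l → i ∈ X → l ∈ X → j ∈ X) → ConnectedSet (pathGraph m) X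
interval-connected {m} X between u v p q = [ (λ le → upward _ u v ≤-refl le p q) ,
    (λ le → walk-sym (upward _ v u ≤-refl le q p)) ]′ (≤-total (toℕ u) (toℕ v))
  where
  upward : ∀ f u v → toℕ v ∸ toℕ u < f → toℕ u ≤ toℕ v → u ∈ X → v ∈ X → Walk (pathGraph m) X u v
  upward (suc f) u v (s≤s lt) le p q with m≤n⇒m<n∨m≡n le
  ... | inj₂ eq with refl ← toℕ-injective eq = stop p
  ... | inj₁ u<v = step p (∈⁺ (consecutive? u) w (inj₁ (≡.sym w-eq)))
      (upward f w v (<-≤-trans (∸-monoʳ-< (≤-reflexive (≡.sym w-eq)) w≤v) lt) w≤v
        (between u w v (≤-trans (n≤1+n _) (≤-reflexive (≡.sym w-eq))) w≤v p q) q)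
    where
    w = fromℕ< (≤-<-trans u<v (toℕ<n v))
    w-eq : toℕ w ≡ suc (toℕ u)
    w-eq = toℕ-fromℕ< _
    w≤v : toℕ w ≤ toℕ v
    w≤v = ≤-trans (≤-reflexive w-eq) u<v

-- A non-repeating sequence with steps ±1 cannot turn back.
steps-up : ∀ l (h : Fin (2 + l) → ℕ) → Injective _≡_ _≡_ h →
  (∀ (i : Fin (suc l)) → suc (h (inject₁ i)) ≡ h (suc i) ⊎ suc (h (suc i)) ≡ h (inject₁ i)) →
  suc (h zero) ≡ h (suc zero) → ∀ i → h i ≡ toℕ i + h zero
steps-up _ h _ _ _ zero = refl
steps-up zero h _ _ up (suc zero) = ≡.sym up
steps-up (suc l) h inj pm up (suc i) with pm (suc zero)
... | inj₂ down with () ← inj (ℕₚ.suc-injective (trans down (≡.sym up)))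
... | inj₁ up′ = trans (steps-up l (h ∘ suc) (suc-injective ∘ inj) (pm ∘ suc) up′ i)
  (trans (cong (toℕ i +_) (≡.sym up)) (+-suc (toℕ i) _))

steps-down : ∀ l (h : Fin (2 + l) → ℕ) → Injective _≡_ _≡_ h →
  (∀ (i : Fin (suc l)) → suc (h (inject₁ i)) ≡ h (suc i) ⊎ suc (h (suc i)) ≡ h (inject₁ i)) →
  suc (h (suc zero)) ≡ h zero → ∀ i → h zero ≡ toℕ i + h i
steps-down _ h _ _ _ zero = refl
steps-down zero h _ _ down (suc zero) = ≡.sym down
steps-down (suc l) h inj pm down (suc i) with pm (suc zero)
... | inj₁ up with () ← inj (trans (≡.sym up) down)
... | inj₂ down′ = trans (≡.sym down)
  (cong suc (steps-down l (h ∘ suc) (suc-injective ∘ inj) (pm ∘ suc) down′ i))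

-- The positions along a cycle change by one without repetition, so they are monotone. The first and
-- the last are then `2 + k` apart, too far for the closing edge.
pathGraph-acyclic : ∀ m → ¬ HasCycle (pathGraph m)
pathGraph-acyclic m (k , f , inj , edges , close) = [ cases-up , cases-down ]′ (pm zero)
  where
  h = toℕ ∘ f
  h-inj : Injective _≡_ _≡_ h
  h-inj = inj ∘ toℕ-injective
  pm : ∀ (i : Fin (2 + k)) → suc (h (inject₁ i)) ≡ h (suc i) ⊎ suc (h (suc i)) ≡ h (inject₁ i)
  pm i = ∈⁻ (consecutive? (f (inject₁ i))) (f (suc i)) (edges i)
  last = fromℕ (2 + k)
  far : ∀ {x y} → x ≡ toℕ last + y → ¬ (suc x ≡ y ⊎ suc y ≡ x)
  far {x} {y} eq rewrite toℕ-fromℕ k with eq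
  ... | refl = λ { (inj₁ q) → m≢1+n+m y (≡.sym q)
                 ; (inj₂ q) → m≢1+n+m y (ℕₚ.suc-injective q) }
  ends : suc (h last) ≡ h zero ⊎ suc (h zero) ≡ h last
  ends = ∈⁻ (consecutive? (f last)) (f zero) close
  swap : ∀ {A B : Set} → A ⊎ B → B ⊎ A
  swap = [ inj₂ , inj₁ ]′
  cases-up : _ → ⊥
  cases-up up = far (steps-up (suc k) h h-inj pm up last) ends
  cases-down : _ → ⊥
  cases-down down = far (steps-down (suc k) h h-inj pm down last) (swap ends)

pathwidth⇒treewidth : ∀ {H b} → 1 ≤ n H → PathwidthAtMost H b → TreewidthAtMost H b
pathwidth⇒treewidth {H} 1≤n P = record
  { T = pathGraph m
  ; isTree = (nonempty , interval-connected full (λ _ _ _ _ _ _ _ → refl)) , pathGraph-acyclic m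
  ; bag = bag
  ; covers = PathDecomposition.covers P
  ; edgesIn = edgesIn
  ; subtree = λ v → interval-connected (λ x → bag x v) (interval v)
  ; width = width
  }
  where
  open PathDecomposition P hiding (covers)
  -- A tree must have a vertex; the bag covering some vertex of `H` supplies one.
  nonempty : 1 ≤ m
  nonempty = ≤-<-trans z≤n (toℕ<n (proj₁ (PathDecomposition.covers P (fromℕ< 1≤n))))

-- Red–blue colouring

-- G[X] with the vertices of red removed is a disjoint union of m induced paths.
record Linear (G : Graph) (X : VSet G) (r p : ℕ) : Set where
  field
    red       : VSet G
    red⊆X     : red ⊆ X
    red-count : countF red ≤ r
    m         : ℕ
    m≤p       : m ≤ p
    len       : Fin m → ℕ
    at        : ∀ j → Fin (len j) → Vtx G
    at-inj    : ∀ j {a b} → at j a ≡ at j b → a ≡ b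
    at-blue   : ∀ j a → at j a ∈ X × at j a ∉ red
    at-covers : ∀ v → v ∈ X → v ∉ red → ∃[ j ] ∃[ a ] at j a ≡ v
    at-edge   : ∀ j a b → Edge G (at j a) (at j b) ⇔ Consecutive a b
    apart     : ∀ i j a b → i ≢ j → at i a ≢ at j b × ¬ Edge G (at i a) (at j b)

linear⇒redBlue : ∀ {H X r p} → (∀ x → x ∈ X) → Linear H X r p → RedBlue H r p
linear⇒redBlue {H} {X} all L = red , red-count , m , m≤p , len , (λ (j , a) → at j a) , inj ,
  (λ (j , a) → not⁺ (proj₂ (at-blue j a))) ,
  (λ v b → let j , a , e = at-covers v (all v) (not⁻ b) in (j , a) , e) ,
  at-edge ,
  (λ (i , a) (j , b) ne → proj₂ (apart i j a b ne))
  where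
  open Linear L
  inj : Injective _≡_ _≡_ (λ ((j , a) : Σ (Fin m) (λ j → Fin (len j))) → at j a)
  inj {i , a} {j , b} e with i ≟ j
  ... | no ne = ⊥-elim (proj₁ (apart i j a b ne) e)
  ... | yes refl with refl ← at-inj i e = refl

-- Following parents from u traces a shortest path to Q.
module Chain {G : Graph} {Q : VSet G} (L : Layering G full Q) (u : Vtx G) where
  open Layering L

  -- Meaningful up to index `dist u`, where `Q` is reached; beyond it `par` may return dummy values.
  chain : ℕ → Vtx G
  chain zero = u
  chain (suc i) = par (chain i)

  dist≡0⇒∈ : ∀ x → dist x ≡ 0 → x ∈ Q
  dist≡0⇒∈ x e with x ∈? Q
  ... | yes q = q
  ... | no q = ⊥-elim (dist-∉ x refl q e)

  dist≢0⇒∉ : ∀ {x d} → dist x ≡ suc d → x ∉ Q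
  dist≢0⇒∉ {x} e q with () ← trans (≡.sym (dist-∈ x q)) e

  chain-dist : ∀ i {d} → i + d ≡ dist u → dist (chain i) ≡ d
  chain-dist zero e = ≡.sym e
  chain-dist (suc i) {d} e = ℕₚ.suc-injective (trans (≡.sym (par-dist (chain i) refl (dist≢0⇒∉ ih))) ih)
    where
    ih : dist (chain i) ≡ suc d
    ih = chain-dist i (trans (+-suc i d) e)

  chain-dist-∸ : ∀ i → i ≤ dist u → dist (chain i) ≡ dist u ∸ i
  chain-dist-∸ i le = chain-dist i (m+[n∸m]≡n le)

  end∈ : chain (dist u) ∈ Q
  end∈ = dist≡0⇒∈ _ (chain-dist (dist u) (+-identityʳ _))

  chain-injective : ∀ i j → i ≤ dist u → j ≤ dist u → chain i ≡ chain j → i ≡ j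
  chain-injective i j p q e = ∸-cancelˡ-≡ p q
    (trans (≡.sym (chain-dist-∸ i p)) (trans (cong dist e) (chain-dist-∸ j q)))

  chain-edge : ∀ i → suc i ≤ dist u → Edge G (chain i) (chain (suc i))
  chain-edge i lt = par-edge (chain i) refl (dist≢0⇒∉
    (chain-dist i (trans (+-suc i _) (m+[n∸m]≡n lt))))

  private
    -- An edge changes the distance to `Q` by at most one, while the distances of the two vertices
    -- differ by `j ∸ i`.
    ahead : ∀ i j → i < j → j ≤ dist u → Edge G (chain i) (chain j) → suc i ≡ j
    ahead i j lt le e = ≤-antisym lt (≤-trans (≤-reflexive (≡.sym (m∸[m∸n]≡n le)))
      (≤-trans (∸-monoʳ-≤ (dist u) lower) (≤-reflexive (m∸[m∸n]≡n (≤-trans lt le)))))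
      where
      lower : dist u ∸ suc i ≤ dist u ∸ j
      lower = ≤-pred (≤-trans (≤-reflexive (suc-∸ lt le)) (subst₂ _≤_
        (chain-dist-∸ i (≤-trans (<⇒≤ lt) le)) (cong suc (chain-dist-∸ j le))
        (lipschitz (chain j) (chain i) refl refl (Edge-sym G e))))
        where
        open ≡ using (subst₂)
        suc-∸ : ∀ {i j d} → i < j → j ≤ d → suc (d ∸ suc i) ≡ d ∸ i
        suc-∸ {i} {j} {d} lt le = ≡.sym (+-∸-assoc 1 (≤-trans lt le))

  chain-chordless : ∀ i j → i ≤ dist u → j ≤ dist u → Edge G (chain i) (chain j) →
    (suc i ≡ j) ⊎ (suc j ≡ i)
  chain-chordless i j p q e with <-cmp i j
  ... | tri< lt _ _ = inj₁ (ahead i j lt q e)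
  ... | tri> _ _ gt = inj₂ (ahead j i gt p (Edge-sym G e))
  ... | tri≈ _ refl _ = ⊥-elim (Edge-irrefl G e)

  -- `l` is free because `firstPath` uses the whole chain and `morePath` only an initial piece.
  chain-consecutive : ∀ {l} → l ≤ suc (dist u) → ∀ (a b : Fin l) →
    Edge G (chain (toℕ a)) (chain (toℕ b)) ⇔ Consecutive a b
  chain-consecutive le a b = mk⇔ (chain-chordless _ _ (below a) (below b)) back
    where
    below : ∀ a → toℕ a ≤ dist u
    below a = ≤-pred (≤-trans (toℕ<n a) le)
    back : Consecutive a b → Edge G (chain (toℕ a)) (chain (toℕ b))
    back (inj₁ e) = subst (λ z → Edge G (chain (toℕ a)) (chain z)) e
      (chain-edge (toℕ a) (subst (_≤ dist u) (≡.sym e) (below b)))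
    back (inj₂ e) = Edge-sym G (subst (λ z → Edge G (chain (toℕ b)) (chain z)) e
      (chain-edge (toℕ b) (subst (_≤ dist u) (≡.sym e) (below a))))

  onChain? : ∀ x → Dec (∃ λ (i : Fin (suc (dist u))) → chain (toℕ i) ≡ x)
  onChain? x = any? λ i → chain (toℕ i) ≟ x

  onChain : ∀ i → i ≤ dist u → chain i ∈ ⟦ onChain? ⟧
  onChain i le = ∈⁺ onChain? (chain i) (fromℕ< (s≤s le) , cong chain (toℕ-fromℕ< (s≤s le)))

  offChain : ∀ x → x ∈ ⟦ onChain? ⟧ → ∃[ i ] (i ≤ dist u × chain i ≡ x)
  offChain x h with i , e ← ∈⁻ onChain? x h = toℕ i , ≤-pred (toℕ<n i) , e

record Grown (G : Graph) (X : VSet G) (u : Vtx G) (r p : ℕ) : Set where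
  field
    X′        : VSet G
    X⊆X′      : X ⊆ X′
    u∈X′      : u ∈ X′
    X′-connected : ConnectedSet G X′
    linear    : Linear G X′ r p

module _ {G : Graph} (c : ConnectedSet G full) where

  private
    layers : ∀ Q → (∃[ q ] q ∈ Q) → Layering G full Q
    layers Q q = layering-connected full Q (λ _ _ → refl) q c

  firstPath : ∀ v u → Grown G ⟦ (_≟ v) ⟧ u 0 1
  firstPath v u = record
    { X′ = ⟦ onChain? ⟧
    ; X⊆X′ = λ x h → subst (_∈ ⟦ onChain? ⟧) (trans end (≡.sym (∈⁻ (_≟ v) x h))) (onChain (dist u) ≤-refl)
    ; u∈X′ = onChain 0 z≤n
    ; X′-connected = descend-connected Q dist (connected-singleton v (∈⁻ (_≟ v)))
        (λ x h → subst (_∈ ⟦ onChain? ⟧) (trans end (≡.sym (∈⁻ (_≟ v) x h))) (onChain (dist u) ≤-refl)) next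
    ; linear = record
      { red = λ _ → false
      ; red⊆X = λ _ ()
      ; red-count = count≤ {n G} {0} (λ _ → false) (λ _ ()) (λ _ _ ())
      ; m = 1
      ; m≤p = ≤-refl
      ; len = λ _ → suc (dist u)
      ; at = λ _ i → chain (toℕ i)
      ; at-inj = λ _ {a} {b} e → toℕ-injective
          (chain-injective (toℕ a) (toℕ b) (≤-pred (toℕ<n a)) (≤-pred (toℕ<n b)) e)
      ; at-blue = λ _ a → onChain (toℕ a) (≤-pred (toℕ<n a)) , λ ()
      ; at-covers = λ x h _ → zero , ∈⁻ onChain? x h
      ; at-edge = λ _ → chain-consecutive ≤-refl
      ; apart = λ { zero zero _ _ ne → ⊥-elim (ne refl) }
      }
    }
    where
    Q = ⟦ (_≟ v) ⟧
    open Layering (layers Q (v , ∈⁺ (_≟ v) v refl))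
    open Chain (layers Q (v , ∈⁺ (_≟ v) v refl)) u
    end : chain (dist u) ≡ v
    end = ∈⁻ (_≟ v) _ (end∈)
    next : ∀ x → x ∈ ⟦ onChain? ⟧ → x ∉ Q →
      ∃[ y ] (y ∈ ⟦ onChain? ⟧ × Edge G x y × dist y < dist x)
    next x h q with i , le , refl ← offChain x h with m≤n⇒m<n∨m≡n le
    ... | inj₂ refl = ⊥-elim (q (end∈))
    ... | inj₁ lt = chain (suc i) , onChain (suc i) lt , chain-edge i lt ,
      ≤-reflexive (≡.sym (par-dist (chain i) refl q))

  -- The chain from u reaches a neighbour of X first; this vertex becomes red and
  -- separates the rest of the chain from X.
  morePath : ∀ {X r p} → (∃[ x ] x ∈ X) → ConnectedSet G X → Linear G X r p → ∀ u →
    Grown G X u (suc r) (suc p)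
  morePath {X} {r} {p} nonempty cX lin u with u ∈? X
  ... | yes u∈ = record
    { X′ = X ; X⊆X′ = λ _ h → h ; u∈X′ = u∈ ; X′-connected = cX
    ; linear = record
      { Linear lin
      ; red-count = m≤n⇒m≤1+n (Linear.red-count lin)
      ; m≤p = m≤n⇒m≤1+n (Linear.m≤p lin)
      }
    }
  ... | no u∉ = record
    { X′ = X′ ; X⊆X′ = X⊆X′ ; u∈X′ = chain∈ 0 z≤n
    ; X′-connected = descend-connected X dist cX X⊆X′ next
    ; linear = record
      { red = red′
      ; red⊆X = λ x h → [ (λ r∈ → X⊆X′ x (red⊆X x r∈)) , (λ { refl → chain∈ l (m∸n≤m (dist u) 1) }) ]′ (∈⁻ red? x h)
      -- Only `z` is new: without it, `red′` is contained in `red`.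
      ; red-count = ≤-trans (count-remove red′ z) (s≤s (≤-trans
          (count-mono ⟦ rest? ⟧ red λ x h → [ id , (λ e → ⊥-elim (proj₂ (∈⁻ rest? x h) e)) ]′
            (∈⁻ red? x (proj₁ (∈⁻ rest? x h))))
          red-count))
      ; m = suc m
      ; m≤p = s≤s m≤p
      ; len = len′
      ; at = at′
      ; at-inj = at-inj′
      ; at-blue = at-blue′
      ; at-covers = at-covers′
      ; at-edge = at-edge′
      ; apart = apart′
      }
    }
    where
    open Linear lin
    open Layering (layers X nonempty)
    open Chain (layers X nonempty) u

    D≥1 : 1 ≤ dist u
    D≥1 = n≢0⇒n>0 (dist-∉ u refl u∉)

    -- The index of the chain vertex at distance 1 from `X`, which becomes red, and so also the
    -- number of new blue vertices before it.
    l : ℕ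
    l = dist u ∸ 1

    1+l : suc l ≡ dist u
    1+l = m+[n∸m]≡n D≥1

    z : Vtx G
    z = chain l

    z-dist : dist z ≡ 1
    z-dist = chain-dist l (trans (+-comm l 1) 1+l)

    X′? = λ x → (x ∈? X) ⊎-dec onChain? x
    X′ = ⟦ X′? ⟧

    X⊆X′ : X ⊆ X′
    X⊆X′ x h = ∈⁺ X′? x (inj₁ h)

    chain∈ : ∀ i → i ≤ dist u → chain i ∈ X′
    chain∈ i le = ∈⁺ X′? (chain i) (inj₂ (∈⁻ onChain? _ (onChain i le)))

    next : ∀ x → x ∈ X′ → x ∉ X → ∃[ y ] (y ∈ X′ × Edge G x y × dist y < dist x)
    next x h q with ∈⁻ X′? x h
    ... | inj₁ x∈ = ⊥-elim (q x∈)
    ... | inj₂ on with i , le , refl ← offChain x (∈⁺ onChain? x on) with m≤n⇒m<n∨m≡n le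
    ... | inj₂ refl = ⊥-elim (q (end∈))
    ... | inj₁ lt = chain (suc i) , chain∈ (suc i) lt , chain-edge i lt ,
      ≤-reflexive (≡.sym (par-dist (chain i) refl q))

    red? = λ x → (x ∈? red) ⊎-dec (x ≟ z)
    red′ = ⟦ red? ⟧
    rest? = λ x → (x ∈? red′) ×-dec ¬? (x ≟ z)

    below : ∀ (a : Fin l) → toℕ a ≤ dist u
    below a = ≤-trans (<⇒≤ (toℕ<n a)) (m∸n≤m (dist u) 1)

    -- At distance 2 or more, the new path neither meets `X` nor has an edge to it.
    far : ∀ (a : Fin l) → 2 ≤ dist (chain (toℕ a))
    far a = subst (2 ≤_) (≡.sym (chain-dist-∸ (toℕ a) (below a)))
      (m+n≤o⇒m≤o∸n 2 (subst (2 + toℕ a ≤_) 1+l (s≤s (toℕ<n a))))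

    near : ∀ {x} → x ∈ X → ∀ (a : Fin l) → x ≢ chain (toℕ a)
    near x∈ a refl with () ← subst (2 ≤_) (dist-∈ _ x∈) (far a)

    nonadjacent : ∀ {x} → x ∈ X → ∀ (a : Fin l) → ¬ Edge G x (chain (toℕ a))
    nonadjacent {x} x∈ a e = <⇒≱ (far a)
      (subst (λ d → dist (chain (toℕ a)) ≤ suc d) (dist-∈ x x∈) (lipschitz x _ refl refl e))

    z∉X : z ∉ X
    z∉X = dist≢0⇒∉ z-dist

    chain≢z : ∀ (a : Fin l) → chain (toℕ a) ≢ z
    chain≢z a e = <⇒≢ (toℕ<n a) (chain-injective (toℕ a) l (below a) (m∸n≤m (dist u) 1) e)

    len′ : Fin (suc m) → ℕ
    len′ zero = l
    len′ (suc j) = len j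

    at′ : ∀ j → Fin (len′ j) → Vtx G
    at′ zero i = chain (toℕ i)
    at′ (suc j) i = at j i

    at-inj′ : ∀ j {a b} → at′ j a ≡ at′ j b → a ≡ b
    at-inj′ zero {a} {b} e = toℕ-injective (chain-injective (toℕ a) (toℕ b) (below a) (below b) e)
    at-inj′ (suc j) e = at-inj j e

    at-blue′ : ∀ j a → at′ j a ∈ X′ × at′ j a ∉ red′
    at-blue′ zero a = chain∈ (toℕ a) (below a) ,
      λ h → [ (λ r∈ → red∉ r∈) , chain≢z a ]′ (∈⁻ red? _ h)
      where
      red∉ : chain (toℕ a) ∉ red
      red∉ r∈ = near (red⊆X _ r∈) a refl
    at-blue′ (suc j) a with x∈ , b ← at-blue j a = X⊆X′ _ x∈ ,
      λ h → [ b , (λ e → z∉X (subst (_∈ X) e x∈)) ]′ (∈⁻ red? _ h)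

    at-covers′ : ∀ v → v ∈ X′ → v ∉ red′ → ∃[ j ] ∃[ a ] at′ j a ≡ v
    at-covers′ v h b with ∈⁻ X′? v h
    ... | inj₁ v∈ with j , a , e ← at-covers v v∈ (λ r∈ → b (∈⁺ red? v (inj₁ r∈))) = suc j , a , e
    ... | inj₂ on with i , le , refl ← offChain v (∈⁺ onChain? v on) with i ℕₚ.≟ dist u
    -- The end of the chain lies in `X`, so an old path covers it.
    ... | yes refl with j , a , e ← at-covers v end∈ (λ r∈ → b (∈⁺ red? v (inj₁ r∈))) = suc j , a , e
    ... | no i≢D = zero , fromℕ< i<l , cong chain (toℕ-fromℕ< i<l)
      where
      i≢l : i ≢ l
      i≢l refl = b (∈⁺ red? z (inj₂ refl))
      i<l : i < l
      i<l = ≤∧≢⇒< (≤-pred (subst (i <_) (≡.sym 1+l) (≤∧≢⇒< le i≢D))) i≢l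

    at-edge′ : ∀ j a b → Edge G (at′ j a) (at′ j b) ⇔ Consecutive a b
    at-edge′ zero = chain-consecutive (≤-trans (m∸n≤m (dist u) 1) (n≤1+n _))
    at-edge′ (suc j) = at-edge j

    apart′ : ∀ i j a b → i ≢ j → at′ i a ≢ at′ j b × ¬ Edge G (at′ i a) (at′ j b)
    apart′ zero zero a b ne = ⊥-elim (ne refl)
    apart′ zero (suc j) a b _ = (λ e → near (proj₁ (at-blue j b)) a (≡.sym e)) ,
      λ e → nonadjacent (proj₁ (at-blue j b)) a (Edge-sym G e)
    apart′ (suc i) zero a b _ = near (proj₁ (at-blue i a)) b , nonadjacent (proj₁ (at-blue i a)) b
    apart′ (suc i) (suc j) a b ne = apart i j a b (ne ∘ cong suc)

  -- The last two terminals need one path and no red vertex; each of the other `k` adds at most one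
  -- path and one red vertex.
  cover : ∀ {k} (a : Fin (2 + k) → Vtx G) → ∃[ X ] (Spans G a X × Linear G X k (suc k))
  cover {zero} a = X′ , (X′-connected , span) , linear
    where
    open Grown (firstPath (a zero) (a (suc zero)))
    span : ∀ i → a i ∈ X′
    span zero = X⊆X′ _ (∈⁺ (_≟ a zero) _ refl)
    span (suc zero) = u∈X′
  cover {suc k} a with X , (cX , sX) , lin ← cover (a ∘ suc) = X′ , (X′-connected , span) , linear
    where
    open Grown (morePath (a (suc zero) , sX zero) cX lin (a zero))
    span : ∀ i → a i ∈ X′
    span zero = u∈X′
    span (suc i) = X⊆X′ _ (sX i)

redBlue-terminals : ∀ {H k} (a : Fin (2 + k) → Vtx H) → ConnectedSet H full → Minimal H a → RedBlue H k (suc k)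
redBlue-terminals a c min with X , spans , lin ← cover c a = linear⇒redBlue (min X spans) lin

-- Clustered 2-colouring

parity : ℕ → Bool
parity zero = true
parity (suc i) = not (parity i)

parity≢suc : ∀ i → parity i ≢ parity (suc i)
parity≢suc i e = Boolₚ.not-¬ refl e

-- Adjacent vertices lie in equal or consecutive layers, so a colouring by parity separates
-- different layers.
parity-close : ∀ {i j} → i ≤ suc j → j ≤ suc i → parity i ≡ parity j → i ≡ j
parity-close {i} {j} p q e with <-cmp i j
... | tri≈ _ eq _ = eq
... | tri< lt _ _ with refl ← ≤-antisym q lt = ⊥-elim (parity≢suc i e)
... | tri> _ _ gt with refl ← ≤-antisym p gt = ⊥-elim (parity≢suc j (≡.sym e))

xor-cancelˡ : ∀ b {x y} → b xor x ≡ b xor y → x ≡ y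
xor-cancelˡ false e = e
xor-cancelˡ true e = Boolₚ.not-injective e

xor-cancelʳ : ∀ b {x y} → x xor b ≡ y xor b → x ≡ y
xor-cancelʳ b {x} {y} e = xor-cancelˡ b (trans (Boolₚ.xor-comm b x) (trans e (Boolₚ.xor-comm y b)))

count-disjoint : ∀ {n} (f g : Fin n → Bool) → (∀ x → x ∈ f → x ∉ g) → countF f + countF g ≤ n
count-disjoint {zero} f g _ = z≤n
count-disjoint {suc n} f g dis with f zero in p | g zero in q | count-disjoint (f ∘ suc) (g ∘ suc) (dis ∘ suc)
... | true | true | _ = ⊥-elim (dis zero p q)
... | true | false | le = s≤s le
... | false | true | le = subst (_≤ suc n) (≡.sym (+-suc _ _)) (s≤s le)
... | false | false | le = m≤n⇒m≤1+n le

module _ {H : Graph} {k : ℕ} (a : Fin k → Vtx H) (cH : ConnectedSet H full) (min : Minimal H a) where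

  private
    away? : ∀ (u x : Vtx H) → Dec (x ≢ u)
    away? u x = ¬? (x ≟ u)

    comp : Vtx H → Vtx H → VSet H
    comp u = component H ⟦ away? u ⟧

    terminals : Vtx H → Vtx H → ℕ
    terminals u x = countF (λ i → comp u x (a i))

    layersFrom : ∀ u → Layering H full ⟦ (_≟ u) ⟧
    layersFrom u = layering-connected full _ (λ _ _ → refl) (u , ∈⁺ (_≟ u) u refl) cH

    module L u = Layering (layersFrom u)

    dist-self : ∀ u → L.dist u u ≡ 0
    dist-self u = L.dist-∈ u u (∈⁺ (_≟ u) u refl)

    ≢⇒∉ : ∀ {u x : Vtx H} → x ≢ u → x ∉ ⟦ (_≟ u) ⟧
    ≢⇒∉ {u} {x} ne h = ne (∈⁻ (_≟ u) x h)

    comp-self : ∀ {u x} → x ≢ u → x ∈ comp u x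
    comp-self {u} {x} ne = component⁺ H _ x (stop (∈⁺ (away? u) x ne))

    comp-≢ : ∀ {u x y} → y ∈ comp u x → y ≢ u
    comp-≢ {u} {x} {y} h = ∈⁻ (away? u) y (walk-target (component⁻ H _ x h))

    comp-closed : ∀ {u x y z} → y ∈ comp u x → z ≢ u → Edge H y z → z ∈ comp u x
    comp-closed {u} {x} {y} {z} h ne e = component-closed H _ x y z h (∈⁺ (away? u) z ne) e

    comp-trans : ∀ {u x y z} → y ∈ comp u x → z ∈ comp u y → z ∈ comp u x
    comp-trans {u} {x} {y} p q = component⁺ H _ x (walk-trans (component⁻ H _ x p) (component⁻ H _ y q))

    comp-sym : ∀ {u x y} → y ∈ comp u x → x ∈ comp u y
    comp-sym {u} {x} {y} p = component⁺ H _ y (walk-sym (component⁻ H _ x p))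

    comp-attached : ∀ {u x} → x ≢ u → ∃[ y ] (y ∈ comp u x × Edge H y u)
    comp-attached {u} {x} ne
      with y , z , y∈ , z∉ , _ , _ , e ← walk-exit (comp u x) (cH x u refl refl) (comp-self ne) (λ h → comp-≢ h refl)
      with z ≟ u
    ... | yes refl = y , y∈ , e
    ... | no z≢u = ⊥-elim (z∉ (comp-closed y∈ z≢u e))

    -- `boundary≤terminals` is applied to all vertices except those of `comp u x` at distance at
    -- least `i` from `u`. This set is closed under parents, contains the parents of `C`, and misses
    -- only terminals in `comp u x`.
    layer≤terminals : ∀ u x C i → C ⊆ comp u x → (∀ y → y ∈ C → L.dist u y ≡ i) → countF C ≤ terminals u x
    layer≤terminals u x C i C⊆ level = ≤-trans
      (boundary≤terminals a cH min ⟦ Q? ⟧ (u , u∈Q) Q-connected C outside)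
      (count-mono _ _ λ l h → inComp l (not⁻ h))
      where
      open L u
      Q? = λ y → ¬? ((y ∈? comp u x) ×-dec (i ≤? dist y))

      u∈Q : u ∈ ⟦ Q? ⟧
      u∈Q = ∈⁺ Q? u λ (h , _) → comp-≢ h refl

      inComp : ∀ l → a l ∉ ⟦ Q? ⟧ → a l ∈ comp u x
      inComp l h = decidable-stable (a l ∈? comp u x) λ p → h (∈⁺ Q? (a l) (p ∘ proj₁))

      Q-connected : ConnectedSet H ⟦ Q? ⟧
      Q-connected = descend-connected ⟦ (_≟ u) ⟧ dist (connected-singleton u (∈⁻ (_≟ u)))
        (λ y h → subst (_∈ ⟦ Q? ⟧) (≡.sym (∈⁻ (_≟ u) y h)) u∈Q) next
        where
        next : ∀ y → y ∈ ⟦ Q? ⟧ → y ∉ ⟦ (_≟ u) ⟧ →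
          ∃[ z ] (z ∈ ⟦ Q? ⟧ × Edge H y z × dist z < dist y)
        next y y∈ y∉ = par y , ∈⁺ Q? (par y) back , par-edge y refl y∉ , lt
          where
          lt : dist (par y) < dist y
          lt = ≤-reflexive (≡.sym (par-dist y refl y∉))
          back : ¬ (par y ∈ comp u x × i ≤ dist (par y))
          back (p , le) = ∈⁻ Q? y y∈
            (comp-closed p (λ e → y∉ (∈⁺ (_≟ u) y e)) (Edge-sym H (par-edge y refl y∉)) ,
             ≤-trans le (<⇒≤ lt))

      outside : ∀ w → w ∈ C → w ∉ ⟦ Q? ⟧ × w ∈ neighbours H ⟦ Q? ⟧
      outside w w∈ = (λ h → ∈⁻ Q? w h (C⊆ w w∈ , ≤-reflexive (≡.sym (level w w∈)))) ,
        neighbours⁺ H ⟦ Q? ⟧ (∈⁺ Q? (par w) λ (_ , le) → 1+n≰n (subst₂ _≤_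
          (trans (≡.sym (level w w∈)) (par-dist w refl w∉)) refl le))
          (par-edge w refl w∉)
        where
        open ≡ using (subst₂)
        w∉ : w ∉ ⟦ (_≟ u) ⟧
        w∉ = ≢⇒∉ {u} {w} (comp-≢ (C⊆ w w∈))

  module _ {c : ℕ} where

    -- Every vertex x belongs to a part hanging off H at base x; different parts are
    -- joined only by edges between their bases.
    record Bases : Set where
      field
        base       : Vtx H → Vtx H
        side       : Vtx H → Bool
        base-light : ∀ x → terminals (base x) x ≤ c
        base-edge  : ∀ x y → Edge H x y → base x ≡ base y ⊎ (base x ≡ x × base y ≡ y)
        side-count : ∀ b (X : VSet H) → (∀ x → x ∈ X → base x ≡ x × side x ≡ b) → countF X ≤ c

    -- The colour is the parity of the distance from the base, flipped by the side of the base. A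
    -- monochromatic component either consists of bases on one side, or lies in one layer of one
    -- part and in one component of `H` minus its base; there `layer≤terminals` applies.
    bases⇒clustered : Bases → Clustered2Colourable H c
    bases⇒clustered B = colour , λ
      { C (inj₁ (ne , C⊆ , conn , _)) → cluster C ne conn true C⊆
      ; C (inj₂ (ne , C⊆ , conn , _)) → cluster C ne conn false λ x p → ∉⇒≡false (not⁻ (C⊆ x p)) }
      where
      open Bases B
      colour : VSet H
      colour x = side (base x) xor parity (L.dist (base x) x)

      same-base : ∀ u x y → base x ≡ u → base y ≡ u → Edge H x y → colour x ≡ colour y →
        L.dist u x ≡ L.dist u y
      same-base _ x y refl by e eq = parity-close (L.lipschitz u y x refl refl (Edge-sym H e))
        (L.lipschitz u x y refl refl e)
        (xor-cancelˡ (side u) (subst (λ v → colour x ≡ side v xor parity (L.dist v y)) by eq))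
        where u = base x

      module _ (C : VSet H) (conn : ConnectedSet H C) (b : Bool) (mono : ∀ x → x ∈ C → colour x ≡ b) where

        same : ∀ {x y} → x ∈ C → y ∈ C → colour x ≡ colour y
        same p q = trans (mono _ p) (≡.sym (mono _ q))

        at-base : ∀ x₀ → x₀ ∈ C → base x₀ ≡ x₀ → countF C ≤ c
        at-base x₀ p₀ b₀ = side-count (side x₀) C λ y q →
          walk-preserves P next (conn x₀ y p₀ q) (b₀ , refl)
          where
          P : Vtx H → Set
          P y = base y ≡ y × side y ≡ side x₀
          next : ∀ x y → x ∈ C → y ∈ C → Edge H x y → P x → P y
          next x y p q e (bx , sx) with base-edge x y e
          -- A neighbour in the part of `x` with the colour of `x` would be at distance 0 from `x`.
          ... | inj₁ eq = ⊥-elim (L.dist-∉ x y refl (≢⇒∉ {x} {y} λ { refl → Edge-irrefl H e })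
            (trans (≡.sym (same-base x x y bx (trans (≡.sym eq) bx) e (same p q))) (dist-self x)))
          ... | inj₂ (_ , by) = by , trans (≡.sym sides) sx
            where
            at-self : ∀ z → base z ≡ z → colour z ≡ side z xor true
            at-self z bz rewrite bz | dist-self z = refl
            -- Both are at distance 0 from their bases, so equal colours mean equal sides.
            sides : side x ≡ side y
            sides = xor-cancelʳ true (trans (≡.sym (at-self x bx)) (trans (same p q) (at-self y by)))

        off-base : ∀ x₀ → x₀ ∈ C → x₀ ≢ base x₀ → countF C ≤ c
        off-base x₀ p₀ ne = ≤-trans
          (layer≤terminals u x₀ C (L.dist u x₀) (λ y q → proj₁ (proj₂ (spread y q))) (λ y q → proj₂ (proj₂ (spread y q))))
          (base-light x₀)
          where
          u = base x₀
          P : Vtx H → Set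
          P y = base y ≡ u × y ∈ comp u x₀ × L.dist u y ≡ L.dist u x₀
          next : ∀ x y → x ∈ C → y ∈ C → Edge H x y → P x → P y
          next x y p q e (bx , x∈ , dx) with base-edge x y e
          -- `x` would be the base `u`, which `comp u x₀` avoids.
          ... | inj₂ (bx′ , _) = ⊥-elim (comp-≢ x∈ (trans (≡.sym bx′) bx))
          ... | inj₁ eq = by , comp-closed x∈ y≢u e , dy
            where
            by : base y ≡ u
            by = trans (≡.sym eq) bx
            dy : L.dist u y ≡ L.dist u x₀
            dy = trans (≡.sym (same-base u x y bx by e (same p q))) dx
            y≢u : y ≢ u
            y≢u y≡u = L.dist-∉ u x₀ refl (≢⇒∉ {u} {x₀} ne)
              (trans (≡.sym dy) (trans (cong (L.dist u) y≡u) (dist-self u)))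
          spread : ∀ y → y ∈ C → P y
          spread y q = walk-preserves P next (conn x₀ y p₀ q) (refl , comp-self ne , refl)

        cluster′ : ∃[ x ] x ∈ C → countF C ≤ c
        cluster′ (x₀ , p₀) with x₀ ≟ base x₀
        ... | yes e = at-base x₀ p₀ (≡.sym e)
        ... | no ne = off-base x₀ p₀ ne

      cluster : ∀ C → ∃[ x ] x ∈ C → ConnectedSet H C → ∀ b → (∀ x → x ∈ C → colour x ≡ b) → countF C ≤ c
      cluster C ne conn b mono = cluster′ C conn b mono ne

    centralBase : 1 ≤ c → ∀ u → (∀ x → terminals u x ≤ c) → Bases
    centralBase 1≤c u light = record
      { base = λ _ → u
      ; side = λ _ → true
      ; base-light = light
      ; base-edge = λ _ _ _ → inj₁ refl
      ; side-count = λ b X h → ≤-trans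
          (count≤ {k = 1} X (λ _ _ → zero) λ x y p q _ → trans (≡.sym (proj₁ (h x p))) (proj₁ (h y q))) 1≤c
      }

    -- If H − u always has a heavy component, the remainders of H outside these components
    -- form a laminar family, and its maximal members are the parts.
    module _ (k≤ : k ≤ c + c) (heavy : ∀ u → ∃[ x ] c < terminals u x) where

      private
        D : Vtx H → VSet H
        D u = comp u (proj₁ (heavy u))

        self∉D : ∀ u → u ∉ D u
        self∉D u h = comp-≢ h refl

        D-closed : ∀ u {x y} → x ∈ D u → y ≢ u → Edge H x y → y ∈ D u
        D-closed u = comp-closed

        D-comp : ∀ u {x y} → x ∈ D u → y ∈ comp u x → y ∈ D u
        D-comp u = comp-trans

        -- The heavy component is unique: two of them would hold more than `c + c`, hence more than
        -- `k`, terminals.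
        heavy⇒∈D : ∀ u x → c < terminals u x → x ∈ D u
        heavy⇒∈D u x lt with proj₁ (heavy u) ∈? comp u x
        ... | yes p = comp-sym p
        ... | no p = ⊥-elim (<⇒≱ (≤-trans (+-mono-≤ (proj₂ (heavy u)) (<⇒≤ lt))
            (count-disjoint (λ i → D u (a i)) (λ i → comp u x (a i)) λ i q r → p (comp-trans r (comp-sym q)))) k≤)

        light : ∀ u x → x ∉ D u → terminals u x ≤ c
        light u x h = ≮⇒≥ (h ∘ heavy⇒∈D u x)

        -- `D u` is connected and avoids `w`, so it lies in one component of `H` minus `w`. That
        -- component is heavy, hence is `D w`, and it contains `u` because `u` is adjacent to `D u`.
        nested : ∀ u w → w ∉ D u → w ≢ u → u ∈ D w × D u ⊆ D w
        nested u w w∉ ne = u∈ , D⊆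
          where
          h = proj₁ (heavy u)
          -- The set `comp u u` is empty and cannot hold more than `c` terminals.
          h≢u : h ≢ u
          h≢u e = n≮0 (≤-trans (proj₂ (heavy u)) (≤-trans
            (count-mono (λ i → comp u h (a i)) (λ _ → false) λ i q → ⊥-elim
              (∈⁻ (away? u) h (walk-source (component⁻ H _ h q)) e))
            (count≤ {k} {0} (λ _ → false) (λ _ ()) λ _ _ ())))
          D⊆comp : D u ⊆ comp w h
          D⊆comp x p = component⁺ H _ h (walk-mono (λ y q → ∈⁺ (away? w) y λ { refl → w∉ q })
            (component-connected H ⟦ away? u ⟧ h h x (comp-self h≢u) p))
          h∈ : h ∈ D w
          h∈ = heavy⇒∈D w h (≤-trans (proj₂ (heavy u)) (count-mono _ _ λ i → D⊆comp (a i)))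
          D⊆ : D u ⊆ D w
          D⊆ x p = D-comp w h∈ (D⊆comp x p)
          u∈ : u ∈ D w
          u∈ with y , y∈ , e ← comp-attached h≢u = D-closed w (D⊆ y y∈) (ne ∘ ≡.sym) e

        -- Maximality of the remainder outside `D u`: by `nested`, a remainder containing `u`
        -- contains the whole remainder of `u`.
        Top : Vtx H → Set
        Top u = ∀ w → w ≢ u → u ∈ D w

        top? : ∀ u → (∃[ w ] (w ≢ u × u ∉ D w)) ⊎ Top u
        top? u with any? (λ w → ¬? (w ≟ u) ×-dec ¬? (u ∈? D w))
        ... | yes p = inj₁ p
        ... | no none = inj₂ λ w ne → decidable-stable (u ∈? D w) λ h → none (w , ne , h)

        -- As long as `u` lies in the remainder of another vertex, that vertex replaces `u`; its
        -- heavy component is strictly smaller and still misses `x`.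
        climb : ∀ fuel u x → countF (D u) < fuel → x ∉ D u → ∃[ v ] (Top v × x ∉ D v)
        climb (suc fuel) u x (s≤s lt) x∉ with top? u
        ... | inj₂ top = u , top , x∉
        ... | inj₁ (w , w≢u , u∉) with w∈ , D⊆ ← nested w u u∉ (w≢u ∘ ≡.sym) =
          climb fuel w x (<-≤-trans (count-< (D w) (D u) D⊆ w w∈ (self∉D w)) lt) (x∉ ∘ D⊆ x)

        findTop : ∀ x → ∃[ v ] (Top v × x ∉ D v)
        findTop x = climb _ x x ≤-refl (self∉D x)

        -- If `u ≢ v` and `x ≢ u`, the component of `x` in `H` minus `u` is not the heavy one, so it
        -- avoids `v`, which lies in `D u`. Being attached to `u`, which lies in `D v`, it puts `x`
        -- into `D v`.
        top-unique : ∀ u v x → Top u → Top v → x ∉ D u → x ∉ D v → u ≡ v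
        top-unique u v x tu tv xu xv with u ≟ v
        ... | yes e = e
        ... | no u≢v with x ≟ u
        ...   | yes refl = ⊥-elim (xv (tu v (u≢v ∘ ≡.sym)))
        ...   | no x≢u with y , y∈ , e ← comp-attached x≢u =
          ⊥-elim (xv (D-comp v (D-closed v u∈Dv (≢v y y∈) (Edge-sym H e))
            (component⁺ H _ y (walk-mono (λ z q → ∈⁺ (away? v) z (≢v z q))
              (component-connected H ⟦ away? u ⟧ x y x y∈ (comp-self x≢u))))))
          where
          u∈Dv : u ∈ D v
          u∈Dv = tu v (u≢v ∘ ≡.sym)
          ≢v : ∀ z → z ∈ comp u x → z ≢ v
          ≢v z z∈ refl = xu (D-comp u (tv u u≢v) (comp-sym z∈))

        base : Vtx H → Vtx H
        base x = proj₁ (findTop x)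

        base-top : ∀ x → Top (base x)
        base-top x = proj₁ (proj₂ (findTop x))

        base-∉ : ∀ x → x ∉ D (base x)
        base-∉ x = proj₂ (proj₂ (findTop x))

        -- `D (base x)` is a component of `H` minus `base x`, so only `base x` itself has edges out
        -- of its remainder.
        base-edge : ∀ x y → Edge H x y → base x ≡ base y ⊎ base x ≡ x
        base-edge x y e with x ≟ base x
        ... | yes eq = inj₂ (≡.sym eq)
        ... | no x≢ with y ≟ base x
        ...   | yes eq = inj₁ (top-unique _ _ y (base-top x) (base-top y)
                  (λ h → self∉D _ (subst (_∈ D (base x)) eq h)) (base-∉ y))
        ...   | no y≢ = inj₁ (top-unique _ _ y (base-top x) (base-top y)
                  (λ h → base-∉ x (D-closed (base x) h x≢ (Edge-sym H e))) (base-∉ y))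

        -- Otherwise `D u` would be a connected set with all terminals that misses `u`, against
        -- minimality.
        index : ∀ u → ∃[ i ] a i ∉ D u
        index u with any? (λ i → ¬? (a i ∈? D u))
        ... | yes p = p
        ... | no none = ⊥-elim (self∉D u (min (D u) (component-connected H _ _ ,
            λ i → decidable-stable (a i ∈? D u) λ h → none (i , h)) u))

        ix : Vtx H → ℕ
        ix u = toℕ (proj₁ (index u))

        ix-injective : ∀ x y → base x ≡ x → base y ≡ y → ix x ≡ ix y → x ≡ y
        ix-injective x y bx by e = top-unique x y (a (proj₁ (index x)))
          (subst Top bx (base-top x)) (subst Top by (base-top y)) (proj₂ (index x))
          (subst (λ i → a i ∉ D y) (≡.sym (toℕ-injective e)) (proj₂ (index y)))

      -- The parts contain distinct terminals, whose indices split the bases evenly.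
      laminarBases : Bases
      laminarBases = record
        { base = base
        ; side = ⟦ (λ u → ix u <? c) ⟧
        ; base-light = λ x → light (base x) x (base-∉ x)
        ; base-edge = edges
        ; side-count = halves
        }
        where
        edges : ∀ x y → Edge H x y → base x ≡ base y ⊎ (base x ≡ x × base y ≡ y)
        edges x y e with base-edge x y e | base-edge y x (Edge-sym H e)
        ... | inj₁ eq | _ = inj₁ eq
        ... | inj₂ _ | inj₁ eq = inj₁ (≡.sym eq)
        ... | inj₂ bx | inj₂ by = inj₂ (bx , by)

        halves : ∀ b (X : VSet H) → (∀ x → x ∈ X → base x ≡ x × does (ix x <? c) ≡ b) → countF X ≤ c
        halves true X h = count≤ X (λ x p → fromℕ< (lt x p)) λ x y p q e →
          ix-injective x y (proj₁ (h x p)) (proj₁ (h y q))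
            (trans (≡.sym (toℕ-fromℕ< (lt x p))) (trans (cong toℕ e) (toℕ-fromℕ< (lt y q))))
          where
          lt : ∀ x → x ∈ X → ix x < c
          lt x p = ∈⁻ (λ u → ix u <? c) x (proj₂ (h x p))
        halves false X h = count≤ X (λ x p → fromℕ< (lt x p)) λ x y p q e →
          ix-injective x y (proj₁ (h x p)) (proj₁ (h y q))
            (∸-cancelʳ-≡ (ge x p) (ge y q)
              (trans (≡.sym (toℕ-fromℕ< (lt x p))) (trans (cong toℕ e) (toℕ-fromℕ< (lt y q)))))
          where
          ge : ∀ x → x ∈ X → c ≤ ix x
          ge x p = ≮⇒≥ λ q → Boolₚ.not-¬ {true} refl (trans (≡.sym (dec-true (ix x <? c) q)) (proj₂ (h x p)))
          -- The indices on this side run from `c` to below `k`, which is at most `c + c`.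
          lt : ∀ x → x ∈ X → ix x ∸ c < c
          lt x p = +-cancelʳ-< c (ix x ∸ c) c (subst (_< c + c) (≡.sym (m∸n+n≡m (ge x p)))
            (<-≤-trans (toℕ<n (proj₁ (index x))) k≤))

    clustered : 1 ≤ c → k ≤ c + c → Clustered2Colourable H c
    clustered 1≤c k≤ with any? (λ u → all? λ x → terminals u x ≤? c)
    ... | yes (u , light) = bases⇒clustered (centralBase 1≤c u light)
    ... | no none = bases⇒clustered (laminarBases k≤ heavy)
      where
      heavy : ∀ u → ∃[ x ] c < terminals u x
      heavy u with any? (λ x → c <? terminals u x)
      ... | yes p = p
      ... | no h = ⊥-elim (none (u , λ x → ≮⇒≥ λ lt → h (x , lt)))

clustered-terminals : ∀ {H k} (a : Fin (suc k) → Vtx H) → ConnectedSet H full → Minimal H a →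
  Clustered2Colourable H ⌈ suc k /2⌉
clustered-terminals {k = k} a c min = clustered a c min (⌈n/2⌉-mono {1} (s≤s z≤n))
  (≤-trans (≤-reflexive (≡.sym (⌊n/2⌋+⌈n/2⌉≡n (suc k)))) (+-monoˡ-≤ _ (⌊n/2⌋≤⌈n/2⌉ (suc k))))

-- Neighbours of an outside vertex

clique-minor : ∀ {G t} (B : Fin t → VSet G) → (∀ i → ∃[ x ] x ∈ B i) → (∀ i → ConnectedSet G (B i)) →
  (∀ i j → toℕ i < toℕ j → (∀ x → x ∈ B i → x ∉ B j) × adjSets G (B i) (B j) ≡ true) → K t ≼ G
clique-minor {G} {t} B nonempty conn pairs = record
  { branch = B
  ; nonempty = nonempty
  ; connected = conn
  ; disjoint = λ i j x ne p → ∉⇒≡false λ q → disjoint′ i j x ne p q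
  ; edges = edges′
  }
  where
  disjoint′ : ∀ i j x → i ≢ j → x ∈ B i → x ∉ B j
  disjoint′ i j x ne p q with <-cmp (toℕ i) (toℕ j)
  ... | tri< lt _ _ = proj₁ (pairs i j lt) x p q
  ... | tri≈ _ e _ = ne (toℕ-injective e)
  ... | tri> _ _ gt = proj₁ (pairs j i gt) x q p
  edges′ : ∀ i j → Edge (K t) i j → adjSets G (B i) (B j) ≡ true
  edges′ i j e with <-cmp (toℕ i) (toℕ j)
  ... | tri< lt _ _ = proj₂ (pairs i j lt)
  ... | tri> _ _ gt = adjSets-sym G (B j) (B i) (proj₂ (pairs j i gt))
  ... | tri≈ _ eq _ with refl ← toℕ-injective eq = ⊥-elim (Edge-irrefl (K t) e)

-- B₀ and B₁ complete the sets containing x₀ and x₁ to two adjacent branch sets outside C.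
record Linked (G : Graph) (C : VSet G) (x₀ x₁ : Vtx G) : Set where
  field
    B₀ B₁    : VSet G
    conn₀    : ConnectedSet G B₀
    conn₁    : ConnectedSet G B₁
    outside₀ : ∀ x → x ∈ C → x ∉ B₀
    outside₁ : ∀ x → x ∈ C → x ∉ B₁
    apart    : ∀ x → x ∈ B₀ → x ∉ B₁
    link₀    : x₀ ∈ neighbours G B₀
    link₁    : x₁ ∈ neighbours G B₁
    joined   : adjSets G B₀ B₁ ≡ true

module _ {G : Graph} {C : VSet G} {k : ℕ} {a : Fin k → Vtx G} {S : VSet G}
         (spans : SpansIn G C a S) (minimum : ∀ Z → SpansIn G C a Z → countF S ≤ countF Z)
         {v : Vtx G} (v∈C : v ∈ C) (v∉S : v ∉ S) where

  private
    S⊆C = proj₁ spans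
    cS  = proj₁ (proj₂ spans)
    a∈S = proj₂ (proj₂ spans)

    N : VSet G
    N x = S x ∧ adj G v x

    S⁺? : ∀ x → Dec (x ∈ S ⊎ x ≡ v)
    S⁺? x = (x ∈? S) ⊎-dec (x ≟ v)

    Q : VSet G
    Q = ⟦ (_≟ v) ⟧

    Q⊆ : Q ⊆ ⟦ S⁺? ⟧
    Q⊆ x h = ∈⁺ S⁺? x (inj₂ (∈⁻ (_≟ v) x h))

    S⊆ : S ⊆ ⟦ S⁺? ⟧
    S⊆ x h = ∈⁺ S⁺? x (inj₁ h)

    v∈Q : v ∈ Q
    v∈Q = ∈⁺ (_≟ v) v refl

    cQ : ConnectedSet G Q
    cQ = connected-singleton v (∈⁻ (_≟ v))

    S∌Q : ∀ {x} → x ∈ S → x ∉ Q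
    S∌Q {x} p q = v∉S (subst (_∈ S) (∈⁻ (_≟ v) x q) p)

    module _ (w₀ : Vtx G) (w₀∈ : w₀ ∈ N) where

      abstract
        S⁺-connected : ConnectedSet G ⟦ S⁺? ⟧
        S⁺-connected = connected-union cS cQ S⊆ Q⊆
          (λ z h → [ inj₁ , (λ { refl → inj₂ v∈Q }) ]′ (∈⁻ S⁺? z h))
          (proj₁ (∧⁻ w₀∈)) v∈Q (Edge-sym G (proj₂ (∧⁻ w₀∈)))

        fromV : Layering G ⟦ S⁺? ⟧ Q
        fromV = layering-connected ⟦ S⁺? ⟧ Q Q⊆ (v , v∈Q) S⁺-connected

      open Subtrees fromV Q⊆ cQ

      owner-N : ∀ {w} → w ∈ N → owner w ≡ w
      owner-N {w} h with p , e ← ∧⁻ h =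
        owner-neighbour w (S⊆ w p) (S∌Q p) (neighbours⁺ G Q v∈Q (Edge-sym G e))

      owner-∈N : ∀ {x} → x ∈ S → owner x ∈ N
      owner-∈N {x} p with q , r , nb ← owner-spec x (S⊆ x p) (S∌Q p)
        with y , y∈ , e ← neighbours⁻ G Q nb with refl ← ∈⁻ (_≟ v) y y∈ =
        ∧⁺ ([ id , (λ eq → ⊥-elim (r (∈⁺ (_≟ v) _ eq))) ]′ (∈⁻ S⁺? _ q)) (Edge-sym G e)

      -- Exchanging two pruned vertices of S for v would give a smaller spanning set.
      prune-two : (Bad : VSet G) → (∀ i → owner (a i) ∉ Bad) →
        ∀ y z → y ∈ S → z ∈ S → y ≢ z → owner y ∈ Bad → owner z ∈ Bad → ⊥
      prune-two Bad good y z y∈ z∈ y≢z oy oz = <⇒≱ fewer (minimum X X-spans)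
        where
        X = ⟦ kept? Bad ⟧
        X⊆ : ∀ x → x ∈ X → x ∈ S ⊎ x ≡ v
        X⊆ x h = ∈⁻ S⁺? x (proj₁ (∈⁻ (kept? Bad) x h))
        X-spans : SpansIn G C a X
        X-spans = (λ x h → [ S⊆C x , (λ { refl → v∈C }) ]′ (X⊆ x h)) , prune-connected Bad ,
          λ i → ∈⁺ (kept? Bad) (a i) (S⊆ _ (a∈S i) , inj₂ (good i))
        pruned : ∀ x → x ∈ S → owner x ∈ Bad → x ∉ X
        pruned x p o h = [ S∌Q p , (λ good → good o) ]′ (proj₂ (∈⁻ (kept? Bad) x h))
        X-v? = λ x → (x ∈? X) ×-dec ¬? (x ≟ v)
        S-y? = λ x → (x ∈? S) ×-dec ¬? (x ≟ y)
        fewer : countF X < countF S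
        fewer = ≤-<-trans (≤-trans (count-remove X v) (count-< ⟦ X-v? ⟧ ⟦ S-y? ⟧
            (λ x h → let p , ne = ∈⁻ X-v? x h in ∈⁺ S-y? x
              ( [ id , (λ e → ⊥-elim (ne e)) ]′ (X⊆ x p)
              , λ { refl → pruned y y∈ oy p }))
            z (∈⁺ S-y? z (z∈ , y≢z ∘ ≡.sym)) λ h → pruned z z∈ oz (proj₁ (∈⁻ X-v? z h))))
          (count-< ⟦ S-y? ⟧ S (λ x h → proj₁ (∈⁻ S-y? x h)) y y∈ λ h → proj₂ (∈⁻ S-y? y h) refl)

      -- For a neighbour `w` of `v`, a terminal hangs below `w`; the subtrees of the other
      -- neighbours can be pruned.
      Good : Vtx G → Set
      Good w = ∃[ i ] owner (a i) ≡ w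

      good? : ∀ w → Dec (Good w)
      good? w = any? λ i → owner (a i) ≟ w

      -- Pruning all subtrees without terminals would remove both `y` and `p`, which `prune-two`
      -- forbids if they differ.
      bad-unique : ∀ p → p ∈ N → ¬ Good p → ∀ y → y ∈ S → ¬ Good (owner y) → y ≡ p
      bad-unique p p∈ bad y y∈ bad-y with y ≟ p
      ... | yes e = e
      ... | no ne = ⊥-elim (prune-two ⟦ ¬? ∘ good? ⟧
        (λ i h → ∈⁻ (¬? ∘ good?) (owner (a i)) h (i , refl)) y p y∈ (proj₁ (∧⁻ p∈)) ne
        (∈⁺ (¬? ∘ good?) (owner y) bad-y)
        (∈⁺ (¬? ∘ good?) (owner p) (subst (¬_ ∘ Good) (≡.sym (owner-N p∈)) bad)))

      N-bad-unique : ∀ {w w′} → w ∈ N → w′ ∈ N → ¬ Good w → ¬ Good w′ → w ≡ w′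
      N-bad-unique {w} {w′} p q b b′ =
        bad-unique w′ q b′ w (proj₁ (∧⁻ p)) (subst (¬_ ∘ Good) (≡.sym (owner-N p)) b)

      -- Good neighbours are told apart by terminals in their subtrees; `zero` is reserved for the
      -- only possible bad one.
      N≤suc : countF N ≤ suc k
      N≤suc = count≤ N (λ w _ → φ (good? w)) λ w w′ p q → φ-inj p q (good? w) (good? w′)
        where
        φ : ∀ {w} → Dec (Good w) → Fin (suc k)
        φ (yes (i , _)) = suc i
        φ (no _) = zero
        φ-inj : ∀ {w w′} → w ∈ N → w′ ∈ N → (d : Dec (Good w)) (d′ : Dec (Good w′)) → φ d ≡ φ d′ → w ≡ w′
        φ-inj _ _ (yes (_ , refl)) (yes (_ , refl)) e = cong (owner ∘ a) (suc-injective e)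
        φ-inj p q (no b) (no b′) _ = N-bad-unique p q b b′

      N≤-all-good : (∀ w → w ∈ N → Good w) → countF N ≤ k
      N≤-all-good good = count≤ N (λ w p → proj₁ (good w p)) λ w w′ p q e →
        trans (≡.sym (proj₂ (good w p))) (trans (cong (owner ∘ a) e) (proj₂ (good w′ q)))

      N≤2-one-owner : ∀ u → (∀ i → owner (a i) ≡ u) → countF N ≤ 2
      N≤2-one-owner u own = count≤ N (λ w _ → φ (good? w)) λ w w′ p q → φ-inj p q (good? w) (good? w′)
        where
        φ : ∀ {w} → Dec (Good w) → Fin 2
        φ (yes _) = suc zero
        φ (no _) = zero
        φ-inj : ∀ {w w′} → w ∈ N → w′ ∈ N → (d : Dec (Good w)) (d′ : Dec (Good w′)) → φ d ≡ φ d′ → w ≡ w′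
        φ-inj _ _ (yes (i , refl)) (yes (j , refl)) _ = trans (own i) (≡.sym (own j))
        φ-inj p q (no b) (no b′) _ = N-bad-unique p q b b′

      D : Vtx G → VSet G
      D w = ⟦ inSubtree? w ⟧

      D⁺ : ∀ {x w} → x ∈ S → owner x ≡ w → x ∈ D w
      D⁺ {x} {w} p o = ∈⁺ (inSubtree? w) x (S⊆ x p , S∌Q p , o)

      D⁻ : ∀ {x w} → x ∈ D w → x ∈ S × owner x ≡ w
      D⁻ {x} {w} h with q , r , o ← ∈⁻ (inSubtree? w) x h =
        [ id , (λ e → ⊥-elim (r (∈⁺ (_≟ v) x e))) ]′ (∈⁻ S⁺? x q) , o

      -- p is the only vertex of S outside D w and D w′, so by minimality p joins them.
      bad-neighbours : ∀ p → p ∈ N → ¬ Good p → ∀ i j →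
        (∀ l → owner (a l) ≡ owner (a i) ⊎ owner (a l) ≡ owner (a j)) →
        p ∈ neighbours G (D (owner (a i)))
      bad-neighbours p p∈ bad i j own =
        decidable-stable (p ∈? neighbours G (D w)) contra
        where
        w = owner (a i)
        w′ = owner (a j)
        p∉ : ∀ {l} → p ∉ D (owner (a l))
        p∉ {l} h = bad (l , trans (≡.sym (proj₂ (D⁻ h))) (owner-N p∈))
        U? = λ x → (x ∈? D w) ⊎-dec (x ∈? D w′)
        U∌p : p ∉ ⟦ U? ⟧
        U∌p h = [ p∉ , p∉ ]′ (∈⁻ U? p h)
        U⊆S : ⟦ U? ⟧ ⊆ S
        U⊆S x h = [ proj₁ ∘ D⁻ , proj₁ ∘ D⁻ ]′ (∈⁻ U? x h)
        place : ∀ y → y ∈ S → y ≡ p ⊎ y ∈ D w ⊎ y ∈ D w′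
        place y y∈ with good? (owner y)
        ... | no b = inj₁ (bad-unique p p∈ bad y y∈ b)
        ... | yes (l , e) with own l
        ...   | inj₁ el = inj₂ (inj₁ (D⁺ y∈ (trans (≡.sym e) el)))
        ...   | inj₂ el = inj₂ (inj₂ (D⁺ y∈ (trans (≡.sym e) el)))
        contra : ¬ (p ∉ neighbours G (D w))
        contra isolated with x , y , x∈ , y∉ , _ , y∈S , e ←
            walk-exit (D w) (cS (a i) p (a∈S i) (proj₁ (∧⁻ p∈))) (D⁺ (a∈S i) refl) p∉
          with place y y∈S
        ... | inj₁ refl = isolated (neighbours⁺ G (D w) x∈ (Edge-sym G e))
        ... | inj₂ (inj₁ y∈) = y∉ y∈
        ... | inj₂ (inj₂ y∈) = <⇒≱ (count-< ⟦ U? ⟧ S U⊆S p (proj₁ (∧⁻ p∈)) U∌p)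
          (minimum ⟦ U? ⟧ ((λ z h → S⊆C z (U⊆S z h)) ,
            connected-union (subtree-connected w) (subtree-connected w′)
              (λ z h → ∈⁺ U? z (inj₁ h)) (λ z h → ∈⁺ U? z (inj₂ h)) (λ z → ∈⁻ U? z) x∈ y∈ e ,
            λ l → ∈⁺ U? (a l) ([ inj₁ ∘ D⁺ (a∈S l) , inj₂ ∘ D⁺ (a∈S l) ]′ (own l))))

      -- The branch sets are `v`, `p`, and the two subtrees with terminals, extended by `B₀` and
      -- `B₁`. `v` is adjacent to `p` and to the roots of the subtrees, `p` to both subtrees by
      -- `bad-neighbours`, and `B₀` to `B₁`.
      K₄-minor : ∀ p → p ∈ N → ¬ Good p → ∀ i j → owner (a i) ≢ owner (a j) →
        (∀ l → owner (a l) ≡ owner (a i) ⊎ owner (a l) ≡ owner (a j)) →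
        Linked G C (a i) (a j) → K 4 ≼ G
      K₄-minor p p∈ bad i j ne own linked = clique-minor B
        (λ { zero → v , ∈⁺ (_≟ v) v refl ; (suc zero) → p , ∈⁺ (_≟ p) p refl
           ; (suc (suc zero)) → a i , U⁺ B₀ (inj₁ (ai∈ i))
           ; (suc (suc (suc zero))) → a j , U⁺ B₁ (inj₁ (ai∈ j)) })
        (λ { zero → cQ ; (suc zero) → connected-singleton p (∈⁻ (_≟ p))
           ; (suc (suc zero)) → U-connected i B₀ conn₀ link₀
           ; (suc (suc (suc zero))) → U-connected j B₁ conn₁ link₁ })
        pairs
        where
        open Linked linked
        U? : ∀ (Y : VSet G) w x → Dec (x ∈ D w ⊎ x ∈ Y)
        U? Y w x = (x ∈? D w) ⊎-dec (x ∈? Y)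
        U : VSet G → Vtx G → VSet G
        U Y w = ⟦ U? Y w ⟧
        U⁺ : ∀ Y {w x} → x ∈ D w ⊎ x ∈ Y → x ∈ U Y w
        U⁺ Y {w} {x} = ∈⁺ (U? Y w) x
        U⁻ : ∀ Y {w x} → x ∈ U Y w → x ∈ D w ⊎ x ∈ Y
        U⁻ Y {w} {x} = ∈⁻ (U? Y w) x
        ai∈ : ∀ l → a l ∈ D (owner (a l))
        ai∈ l = D⁺ (a∈S l) refl
        U-connected : ∀ l Y → ConnectedSet G Y → a l ∈ neighbours G Y → ConnectedSet G (U Y (owner (a l)))
        U-connected l Y cY h with y , y∈ , e ← neighbours⁻ G Y h =
          connected-union (subtree-connected (owner (a l))) cY (λ _ → U⁺ Y ∘ inj₁) (λ _ → U⁺ Y ∘ inj₂)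
            (λ _ → U⁻ Y) (ai∈ l) y∈ e
        B : Fin 4 → VSet G
        B zero = Q
        B (suc zero) = ⟦ (_≟ p) ⟧
        B (suc (suc zero)) = U B₀ (owner (a i))
        B (suc (suc (suc zero))) = U B₁ (owner (a j))
        p∈S : p ∈ S
        p∈S = proj₁ (∧⁻ p∈)
        v-pair : ∀ Y → (∀ x → x ∈ C → x ∉ Y) → ∀ l → (∀ x → x ∈ Q → x ∉ U Y (owner (a l))) ×
          adjSets G Q (U Y (owner (a l))) ≡ true
        v-pair Y out l = (λ x q h → [ (λ d → S∌Q (proj₁ (D⁻ d)) q)
            , out x (subst (_∈ C) (≡.sym (∈⁻ (_≟ v) x q)) v∈C) ]′ (U⁻ Y h)) ,
          adjSets⁺ G Q (U Y (owner (a l))) v∈Q (U⁺ Y (inj₁ (D⁺ (proj₁ (∧⁻ o∈)) (owner-N o∈)))) (proj₂ (∧⁻ o∈))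
          where o∈ = owner-∈N (a∈S l)
        p-pair : ∀ Y → (∀ x → x ∈ C → x ∉ Y) → ∀ l → p ∈ neighbours G (D (owner (a l))) →
          (∀ x → x ∈ ⟦ (_≟ p) ⟧ → x ∉ U Y (owner (a l))) ×
          adjSets G ⟦ (_≟ p) ⟧ (U Y (owner (a l))) ≡ true
        p-pair Y out l nb with y , y∈ , e ← neighbours⁻ G (D (owner (a l))) nb = dis ,
          adjSets⁺ G ⟦ (_≟ p) ⟧ (U Y (owner (a l))) (∈⁺ (_≟ p) p refl) (U⁺ Y (inj₁ y∈)) e
          where
          dis : ∀ x → x ∈ ⟦ (_≟ p) ⟧ → x ∉ U Y (owner (a l))
          dis x q h with refl ← ∈⁻ (_≟ p) x q = [ (λ d → bad (l , trans (≡.sym (proj₂ (D⁻ d))) (owner-N p∈)))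
            , out p (S⊆C p p∈S) ]′ (U⁻ Y h)
        pairs : ∀ s t → toℕ s < toℕ t → (∀ x → x ∈ B s → x ∉ B t) × adjSets G (B s) (B t) ≡ true
        pairs zero (suc zero) _ =
          (λ x q h → S∌Q p∈S (subst (_∈ Q) (∈⁻ (_≟ p) x h) q)) ,
          adjSets⁺ G Q ⟦ (_≟ p) ⟧ v∈Q (∈⁺ (_≟ p) p refl) (proj₂ (∧⁻ p∈))
        pairs zero (suc (suc zero)) _ = v-pair B₀ outside₀ i
        pairs zero (suc (suc (suc zero))) _ = v-pair B₁ outside₁ j
        pairs (suc zero) (suc (suc zero)) _ = p-pair B₀ outside₀ i (bad-neighbours p p∈ bad i j own)
        pairs (suc zero) (suc (suc (suc zero))) _ = p-pair B₁ outside₁ j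
          (bad-neighbours p p∈ bad j i λ l → [ inj₂ , inj₁ ]′ (own l))
        pairs (suc (suc zero)) (suc (suc (suc zero))) _ =
          (λ x h h′ → dis x (U⁻ B₀ h) (U⁻ B₁ h′)) ,
          adjSets-mono G {B₀} {B₂} {B₁} {B₃} (λ _ → U⁺ B₀ ∘ inj₂) (λ _ → U⁺ B₁ ∘ inj₂) joined
          where
          B₂ = U B₀ (owner (a i))
          B₃ = U B₁ (owner (a j))
          dis : ∀ x → x ∈ D (owner (a i)) ⊎ x ∈ B₀ → x ∈ D (owner (a j)) ⊎ x ∈ B₁ → ⊥
          dis x (inj₁ d) (inj₁ d′) = ne (trans (≡.sym (proj₂ (D⁻ d))) (proj₂ (D⁻ d′)))
          dis x (inj₁ d) (inj₂ b) = outside₁ x (S⊆C x (proj₁ (D⁻ d))) b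
          dis x (inj₂ b) (inj₁ d) = outside₀ x (S⊆C x (proj₁ (D⁻ d))) b
          dis x (inj₂ b) (inj₂ b′) = apart x b b′
        pairs (suc zero) (suc zero) (s≤s ())
        pairs (suc (suc zero)) (suc zero) (s≤s ())
        pairs (suc (suc zero)) (suc (suc zero)) (s≤s (s≤s ()))
        pairs (suc (suc (suc zero))) (suc zero) (s≤s ())
        pairs (suc (suc (suc zero))) (suc (suc zero)) (s≤s (s≤s ()))
        pairs (suc (suc (suc zero))) (suc (suc (suc zero))) (s≤s (s≤s (s≤s ())))

      -- A third neighbour would need a bad one besides two good ones, and then the two terminals
      -- lie in different subtrees, as `K₄-minor` requires.
      N≤2 : k ≤ 2 → ∀ i j → (∀ l → l ≡ i ⊎ l ≡ j) → ¬ (K 4 ≼ G) →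
        (a i ≢ a j → Linked G C (a i) (a j)) → countF N ≤ 2
      N≤2 k≤2 i j ij noK₄ linked with any? (λ w → (w ∈? N) ×-dec ¬? (good? w))
      ... | no none = ≤-trans
        (N≤-all-good λ w p → decidable-stable (good? w) λ b → none (w , p , b)) k≤2
      ... | yes (p , p∈ , bad) with owner (a i) ≟ owner (a j)
      ...   | yes e = N≤2-one-owner (owner (a j)) λ l →
        [ (λ { refl → e }) , (λ { refl → refl }) ]′ (ij l)
      ...   | no ne = ⊥-elim (noK₄ (K₄-minor p p∈ bad i j ne
        (λ l → [ inj₁ ∘ cong (owner ∘ a) , inj₂ ∘ cong (owner ∘ a) ]′ (ij l))
        (linked (ne ∘ cong owner))))

    -- The search from `v` presupposes a neighbour of `v` in `S`; without one the bound is trivial.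
    or-empty : ∀ b → ((w : Vtx G) → w ∈ N → countF N ≤ b) → countF N ≤ b
    or-empty b f with any? (_∈? N)
    ... | yes (w , p) = f w p
    ... | no none = ≤-trans (count≤ {k = 0} N (λ w p → ⊥-elim (none (w , p))) λ w _ p → ⊥-elim (none (w , p))) z≤n

  attachments≤suc : countF N ≤ suc k
  attachments≤suc = or-empty (suc k) N≤suc

  attachments≤2 : k ≤ 2 → ∀ i j → (∀ l → l ≡ i ⊎ l ≡ j) → ¬ (K 4 ≼ G) →
    (a i ≢ a j → Linked G C (a i) (a j)) → countF N ≤ 2
  attachments≤2 k≤2 i j ij noK₄ linked = or-empty 2 λ w p → N≤2 w p k≤2 i j ij noK₄ linked

-- Building the partition

inject≤′ : ∀ {c k} → c ≤ k → Fin c → Fin k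
inject≤′ le r = fromℕ< (<-≤-trans (toℕ<n r) le)

double-bound : ∀ t → 2 * (4 + t) ∸ 6 ≡ 2 + (t + t)
double-bound t = cong (_∸ 2) (trans (cong (λ z → t + (4 + z)) (+-identityʳ t)) (+-comm t (4 + t)))

two-indices : ∀ {t} → t ≡ 0 → ∀ (l : Fin (2 + t)) → l ≡ zero ⊎ l ≡ suc zero
two-indices refl zero = inj₁ refl
two-indices refl (suc zero) = inj₂ refl

module _ (G : Graph) where

  -- `IsComponentIn` for a predicate instead of a Boolean set, so that it can be moved along logical
  -- equivalences.
  record Comp (P : Vtx G → Set) (C : VSet G) : Set where
    field
      inhabited : ∃[ x ] x ∈ C
      inside    : ∀ x → x ∈ C → P x
      linked    : ConnectedSet G C
      closed    : ∀ x y → x ∈ C → P y → Edge G x y → y ∈ C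

  comp-cong : ∀ {P Q : Vtx G → Set} {C} → (∀ x → P x → Q x) → (∀ x → Q x → P x) → Comp P C → Comp Q C
  comp-cong f g K = record
    { inhabited = inhabited
    ; inside = λ x p → f x (inside x p)
    ; linked = linked
    ; closed = λ x y p q → closed x y p (g y q)
    }
    where open Comp K

  few-adjacent : ∀ {k m} → ¬ (K (2 + k) ≼ G) → (s : Fin m → VSet G) → (∀ i → ConnectedSet G (s i)) →
    (∀ i j x → x ∈ s i → x ∈ s j → i ≡ j) → (J : Fin m → Bool) →
    ∀ {C} → ∃[ x ] x ∈ C → ConnectedSet G C →
    (∀ j → j ∈ J → (∀ x → x ∈ C → x ∉ s j) × adjSets G C (s j) ≡ true) →
    (∀ i j → i ∈ J → j ∈ J → i ≢ j → adjSets G (s i) (s j) ≡ true) → countF J ≤ k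
  few-adjacent {k} {m} noK s conn disj J {C} nonempty cC near pairs = ≮⇒≥ λ lt → noK (minor lt)
    where
    minor : suc k ≤ countF J → K (2 + k) ≼ G
    minor le = clique-minor B inhabited connB pairsB
      where
      e : Fin (suc k) → Fin m
      e l = enum J (inject≤′ le l)
      e∈ : ∀ l → e l ∈ J
      e∈ l = enum-∈ J _
      e-inj : ∀ {l l′} → e l ≡ e l′ → l ≡ l′
      e-inj {l} {l′} q = toℕ-injective (trans (≡.sym (toℕ-fromℕ< _))
        (trans (cong toℕ (enum-injective J q)) (toℕ-fromℕ< _)))
      B : Fin (2 + k) → VSet G
      B zero = C
      B (suc l) = s (e l)
      inhabited : ∀ i → ∃[ x ] x ∈ B i
      inhabited zero = nonempty
      inhabited (suc l) with _ , y , _ , q , _ ← adjSets⁻ G C (s (e l)) (proj₂ (near (e l) (e∈ l))) = y , q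
      connB : ∀ i → ConnectedSet G (B i)
      connB zero = cC
      connB (suc l) = conn (e l)
      pairsB : ∀ i j → toℕ i < toℕ j → (∀ x → x ∈ B i → x ∉ B j) × adjSets G (B i) (B j) ≡ true
      pairsB zero (suc l) _ = near (e l) (e∈ l)
      pairsB (suc l) (suc l′) (s≤s lt) =
        (λ x p q → l≢l′ (e-inj (disj (e l) (e l′) x p q))) ,
        pairs (e l) (e l′) (e∈ l) (e∈ l′) (l≢l′ ∘ e-inj)
        where
        l≢l′ : l ≢ l′
        l≢l′ refl = <-irrefl refl lt

  -- A vertex of C next to each s j with j ∈ J; if there are fewer than k such j, terminals repeat.
  record Terminals {m} (s : Fin m → VSet G) (C : VSet G) (J : Fin m → Bool) (k : ℕ) : Set where
    field
      a        : Fin k → Vtx G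
      a-∈      : ∀ l → a l ∈ C
      touches  : ∀ j → j ∈ J → ∃[ l ] a l ∈ neighbours G (s j)
      distinct : ∀ l l′ → a l ≢ a l′ → ∃[ i ] ∃[ j ] (i ≢ j × i ∈ J × j ∈ J ×
                   a l ∈ neighbours G (s i) × a l′ ∈ neighbours G (s j))

  terminals : ∀ {m} (s : Fin m → VSet G) {C} → ∃[ x ] x ∈ C → ∀ {k} →
    countF (λ j → adjSets G C (s j)) ≤ k → Terminals s C (λ j → adjSets G C (s j)) k
  terminals {m} s {C} (x₀ , x₀∈) {k} le = build (enum J) (enum-injective J) (enum-∈ J) (enum-surjective J) le
    where
    J : Fin m → Bool
    J j = adjSets G C (s j)
    witness : ∀ j → j ∈ J → ∃[ x ] (x ∈ C × x ∈ neighbours G (s j))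
    witness j h with x , y , p , q , e ← adjSets⁻ G C (s j) h = x , p , neighbours⁺ G (s j) q e
    build : ∀ {c} (e : Fin c → Fin m) → (∀ {r r′} → e r ≡ e r′ → r ≡ r′) → (∀ r → e r ∈ J) →
      (∀ j → j ∈ J → ∃[ r ] e r ≡ j) → c ≤ k → Terminals s C J k
    -- When no part is adjacent to `C`, an arbitrary vertex of `C` serves as every terminal.
    build {zero} e _ _ sur _ = record
      { a = λ _ → x₀
      ; a-∈ = λ _ → x₀∈
      ; touches = λ j h → ⊥-elim (none (proj₁ (sur j h)))
      ; distinct = λ _ _ ne → ⊥-elim (ne refl)
      }
      where
      none : Fin 0 → ⊥
      none ()
    build {suc c} e inj e∈ sur le = record
      { a = a
      ; a-∈ = λ l → proj₁ (proj₂ (at (index l)))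
      ; touches = touches
      ; distinct = λ l l′ ne → e (index l) , e (index l′) , (λ q → ne (cong (proj₁ ∘ at) (inj q))) ,
          e∈ _ , e∈ _ , proj₂ (proj₂ (at (index l))) , proj₂ (proj₂ (at (index l′)))
      }
      where
      at : ∀ r → ∃[ x ] (x ∈ C × x ∈ neighbours G (s (e r)))
      at r = witness (e r) (e∈ r)
      -- Surplus positions repeat the terminal of the first adjacent part.
      clip : ∀ {l} → Dec (l < suc c) → Fin (suc c)
      clip (yes p) = fromℕ< p
      clip (no _) = zero
      index : Fin k → Fin (suc c)
      index l = clip (toℕ l <? suc c)
      a : Fin k → Vtx G
      a l = proj₁ (at (index l))
      index-inject : ∀ r → index (inject≤′ le r) ≡ r
      index-inject r with toℕ (inject≤′ le r) <? suc c
      ... | yes p = toℕ-injective (trans (toℕ-fromℕ< p) (toℕ-fromℕ< _))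
      ... | no p = ⊥-elim (p (subst (_< suc c) (≡.sym (toℕ-fromℕ< _)) (toℕ<n r)))
      touches : ∀ j → j ∈ J → ∃[ l ] a l ∈ neighbours G (s j)
      touches j h with r , refl ← sur j h = inject≤′ le r ,
        subst (λ r′ → proj₁ (at r′) ∈ neighbours G (s (e r))) (≡.sym (index-inject r)) (proj₂ (proj₂ (at r)))

  Rest : ∀ {m} → (Fin m → VSet G) → Vtx G → Set
  Rest s x = ∀ i → x ∉ s i

  rest? : ∀ {m} (s : Fin m → VSet G) x → Dec (Rest s x)
  rest? s x = all? λ i → ¬? (x ∈? s i)

  -- Parts are numbered from the most recent one, so those up to and including part i
  -- are the s j with i ≤ j.
  After : ∀ {m} → (Fin m → VSet G) → Fin m → Vtx G → Set
  After s i x = ∀ j → toℕ i ≤ toℕ j → x ∉ s j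

  Clique : ∀ {m} → (Fin m → VSet G) → (Fin m → Set) → VSet G → Set
  Clique s P C = ∀ i j → P i → P j → i ≢ j →
    adjSets G C (s i) ≡ true → adjSets G C (s j) ≡ true → adjSets G (s i) (s j) ≡ true

  Hull : ℕ → VSet G → Set
  Hull k S = Σ (Fin k → Vtx G) λ a → (∀ l → a l ∈ S) × (∀ Z → Z ⊆ S → Spans G a Z → S ⊆ Z)

  -- `now` is the invariant from which the next part is built; `before` and `attached` keep, for
  -- each part, what held just after its removal. Here `t` counts from 4, so there are `2 + t`
  -- terminals.
  record State (t m : ℕ) : Set where
    field
      s         : Fin m → VSet G
      inhabited : ∀ i → ∃[ x ] x ∈ s i
      linked    : ∀ i → ConnectedSet G (s i)
      disj      : ∀ i j x → x ∈ s i → x ∈ s j → i ≡ j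
      hull      : ∀ i → Hull (2 + t) (s i)
      now       : ∀ C → Comp (Rest s) C → Clique s (λ _ → ⊤) C
      before    : ∀ i C → Comp (After s i) C → Clique s (λ j → toℕ i ≤ toℕ j) C
      attached  : ∀ i v → After s i v → countF (λ x → s i x ∧ adj G v x) ≤ 2 * (4 + t) ∸ 6

  module Step {t m} (noK : ¬ (K (4 + t) ≼ G)) (st : State t m) (x₀ : Vtx G) (x₀∈ : Rest (State.s st) x₀) where
    open State st

    private
      R : VSet G
      R = ⟦ rest? s ⟧

      C : VSet G
      C = component G R x₀

      C-inhabited : ∃[ x ] x ∈ C
      C-inhabited = x₀ , component⁺ G R x₀ (stop (∈⁺ (rest? s) x₀ x₀∈))

      C-rest : ∀ x → x ∈ C → Rest s x
      C-rest x h = ∈⁻ (rest? s) x (walk-target (component⁻ G R x₀ h))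

      C-closed : ∀ x y → x ∈ C → Rest s y → Edge G x y → y ∈ C
      C-closed x y p q = component-closed G R x₀ x y p (∈⁺ (rest? s) y q)

      C-comp : Comp (Rest s) C
      C-comp = record
        { inhabited = C-inhabited
        ; inside = C-rest
        ; linked = component-connected G R x₀
        ; closed = C-closed
        }

      T : Terminals s C (λ j → adjSets G C (s j)) (2 + t)
      T = terminals s C-inhabited (few-adjacent noK s linked disj _ C-inhabited (component-connected G R x₀)
        (λ j h → (λ x p → C-rest x p j) , h) (λ i j p q ne → now C C-comp i j _ _ ne p q))

      open Terminals T

      hullC : ∃[ S ] (SpansIn G C a S × (∀ Z → SpansIn G C a Z → countF S ≤ countF Z))
      hullC = steiner G C a (component-connected G R x₀) a-∈

      S : VSet G
      S = proj₁ hullC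

      spans : SpansIn G C a S
      spans = proj₁ (proj₂ hullC)

      minimum : ∀ Z → SpansIn G C a Z → countF S ≤ countF Z
      minimum = proj₂ (proj₂ hullC)

      S⊆C : S ⊆ C
      S⊆C = proj₁ spans

      a∈S : ∀ l → a l ∈ S
      a∈S = proj₂ (proj₂ spans)

      s′ : Fin (suc m) → VSet G
      s′ zero = S
      s′ (suc i) = s i

      rest⁺ : ∀ {x} → Rest s x → x ∉ S → Rest s′ x
      rest⁺ r p zero = p
      rest⁺ r p (suc i) = r i

      disj′ : ∀ i j x → x ∈ s′ i → x ∈ s′ j → i ≡ j
      disj′ zero zero _ _ _ = refl
      disj′ zero (suc j) x p q = ⊥-elim (C-rest x (S⊆C x p) j q)
      disj′ (suc i) zero x p q = ⊥-elim (C-rest x (S⊆C x q) i p)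
      disj′ (suc i) (suc j) x p q = cong suc (disj i j x p q)

      S-hull : Hull (2 + t) S
      S-hull = a , a∈S , λ Z Z⊆S sp x x∈ → decidable-stable (x ∈? Z) λ x∉ →
        <⇒≱ (count-< Z S Z⊆S x x∈ x∉) (minimum Z ((λ z p → S⊆C z (Z⊆S z p)) , sp))

      S-adjacent : ∀ j → adjSets G C (s j) ≡ true → adjSets G S (s j) ≡ true
      S-adjacent j h with l , nb ← touches j h with y , y∈ , e ← neighbours⁻ G (s j) nb =
        adjSets⁺ G S (s j) (a∈S l) y∈ e

      -- If `C′` meets `C` it lies inside `C`, and `S` touches every old part adjacent to `C`.
      -- Otherwise `C′` has no edge to `S` and is still a component of the old remainder.
      now′ : ∀ C′ → Comp (Rest s′) C′ → Clique s′ (λ _ → ⊤) C′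
      now′ C′ comp′ with any? (λ x → (x ∈? C′) ×-dec (x ∈? C))
      ... | yes (x , x∈C′ , x∈C) = clique
        where
        open Comp comp′ renaming (inside to inside′; linked to linked′)
        C′⊆C : C′ ⊆ C
        C′⊆C y y∈ = walk-preserves (_∈ C)
          (λ u v _ v∈ e u∈ → C-closed u v u∈ (λ i → inside′ v v∈ (suc i)) e) (linked′ x y x∈C′ y∈) x∈C
        old : ∀ j → adjSets G C′ (s j) ≡ true → adjSets G C (s j) ≡ true
        old j = adjSets-mono G {C′} {C} {s j} {s j} C′⊆C (λ _ p → p)
        clique : Clique s′ (λ _ → ⊤) C′
        clique zero zero _ _ ne _ _ = ⊥-elim (ne refl)
        clique zero (suc j) _ _ _ _ q = S-adjacent j (old j q)
        clique (suc i) zero _ _ _ p _ = adjSets-sym G S (s i) (S-adjacent i (old i p))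
        clique (suc i) (suc j) u v ne p q = now C C-comp i j u v (ne ∘ cong suc) (old i p) (old j q)
      ... | no none = clique
        where
        open Comp comp′ renaming (inhabited to inhabited′; inside to inside′; linked to linked′; closed to closed′)
        rest : ∀ x → x ∈ C′ → Rest s x
        rest x x∈ i = inside′ x x∈ (suc i)
        no-edge : ∀ x y → x ∈ C′ → y ∈ S → ¬ Edge G x y
        no-edge x y x∈ y∈ e = none (x , x∈ , C-closed y x (S⊆C y y∈) (rest x x∈) (Edge-sym G e))
        still : Comp (Rest s) C′
        still = record
          { inhabited = inhabited′
          ; inside = rest
          ; linked = linked′
          ; closed = λ x y p q e → closed′ x y p (rest⁺ q λ y∈ → no-edge x y p y∈ e) e
          }
        not-zero : adjSets G C′ S ≡ true → ⊥
        not-zero h with x , y , p , q , e ← adjSets⁻ G C′ S h = no-edge x y p q e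
        clique : Clique s′ (λ _ → ⊤) C′
        clique zero _ _ _ _ p _ = ⊥-elim (not-zero p)
        clique (suc i) zero _ _ _ _ q = ⊥-elim (not-zero q)
        clique (suc i) (suc j) u v ne p q = now C′ still i j u v (ne ∘ cong suc) p q

      -- The general bound `3 + t` is within `2 + (t + t)` once `t` is positive. For `t` zero there
      -- are two terminals and no `K 4` minor, and the bound is 2.
      attached-inside : ∀ v → v ∈ C → v ∉ S → countF (λ x → S x ∧ adj G v x) ≤ 2 * (4 + t) ∸ 6
      attached-inside v v∈ v∉ with t ℕₚ.≟ 0
      ... | no t≢0 = ≤-trans (attachments≤suc spans minimum v∈ v∉) (subst (3 + t ≤_) (≡.sym (double-bound t))
        (+-monoʳ-≤ 2 (+-monoˡ-≤ t (n≢0⇒n>0 t≢0))))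
      ... | yes t≡0 = ≤-trans
        (attachments≤2 spans minimum v∈ v∉ (≤-reflexive (cong (2 +_) t≡0)) zero (suc zero) (two-indices t≡0)
          (λ K₄ → noK (subst (λ z → K (4 + z) ≼ G) (≡.sym t≡0) K₄)) link)
        (subst (2 ≤_) (≡.sym (double-bound t)) (m≤m+n 2 (t + t)))
        where
        link : a zero ≢ a (suc zero) → Linked G C (a zero) (a (suc zero))
        link ne with i , j , i≢j , i∈ , j∈ , nb , nb′ ← distinct zero (suc zero) ne = record
          { B₀ = s i ; B₁ = s j ; conn₀ = linked i ; conn₁ = linked j
          ; outside₀ = λ x p → C-rest x p i ; outside₁ = λ x p → C-rest x p j
          ; apart = λ x p q → i≢j (disj i j x p q)
          ; link₀ = nb ; link₁ = nb′
          ; joined = now C C-comp i j _ _ i≢j i∈ j∈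
          }

      attached′ : ∀ i v → After s′ i v → countF (λ x → s′ i x ∧ adj G v x) ≤ 2 * (4 + t) ∸ 6
      attached′ (suc i) v h = attached i v λ j le → h (suc j) (s≤s le)
      attached′ zero v h with v ∈? C
      ... | yes v∈ = attached-inside v v∈ (h zero z≤n)
      ... | no v∉ = ≤-trans (count≤ {k = 0} (λ x → S x ∧ adj G v x) (λ x p → ⊥-elim (far x p))
          (λ x _ p _ → ⊥-elim (far x p))) z≤n
        where
        far : ∀ x → x ∉ (λ x → S x ∧ adj G v x)
        far x p with x∈ , e ← ∧⁻ p =
          v∉ (C-closed x v (S⊆C x x∈) (λ i → h (suc i) z≤n) (Edge-sym G e))

      before′ : ∀ i C′ → Comp (After s′ i) C′ → Clique s′ (λ j → toℕ i ≤ toℕ j) C′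
      -- After the newest part, what is left is the whole new remainder.
      before′ zero C′ comp′ i j _ _ = now′ C′ (comp-cong (λ x h l → h l z≤n) (λ x h l _ → h l) comp′) i j _ _
      before′ (suc i) C′ comp′ (suc j) (suc l) (s≤s p) (s≤s q) ne =
        before i C′ (comp-cong (λ x h j le → h (suc j) (s≤s le))
          (λ { x h (suc j) (s≤s le) → h j le }) comp′) j l p q (ne ∘ cong suc)

    next : State t (suc m)
    next = record
      { s = s′
      ; inhabited = λ { zero → a zero , a∈S zero ; (suc i) → inhabited i }
      ; linked = λ { zero → proj₁ (proj₂ spans) ; (suc i) → linked i }
      ; disj = disj′
      ; hull = λ { zero → S-hull ; (suc i) → hull i }
      ; now = now′
      ; before = before′
      ; attached = attached′
      }

    next-smaller : countF ⟦ rest? (State.s next) ⟧ < countF ⟦ rest? s ⟧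
    next-smaller = count-< ⟦ rest? s′ ⟧ ⟦ rest? s ⟧ (λ x h → ∈⁺ (rest? s) x λ i → ∈⁻ (rest? s′) x h (suc i))
      (a zero) (∈⁺ (rest? s) _ (C-rest _ (S⊆C _ (a∈S zero)))) λ h → ∈⁻ (rest? s′) _ h zero (a∈S zero)

  partition : ∀ {t} → ¬ (K (4 + t) ≼ G) → ∃[ m ] Σ (State t m) λ st → ∀ x → ¬ Rest (State.s st) x
  partition {t} noK = go (suc (countF ⟦ rest? (State.s start) ⟧)) start ≤-refl
    where
    start : State t 0
    start = record
      { s = λ () ; inhabited = λ () ; linked = λ () ; disj = λ () ; hull = λ ()
      ; now = λ _ _ () ; before = λ () ; attached = λ () }
    go : ∀ fuel {m} (st : State t m) → countF ⟦ rest? (State.s st) ⟧ < fuel →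
      ∃[ m ] Σ (State t m) λ st → ∀ x → ¬ Rest (State.s st) x
    go (suc fuel) {m} st (s≤s lt) with any? (rest? (State.s st))
    ... | no none = m , st , λ x h → none (x , h)
    ... | yes (x , h) = go fuel (Step.next noK st x h) (<-≤-trans (Step.next-smaller noK st x h) lt)

-- From vertex sets to induced subgraphs

opposite-anti : ∀ {m} {i j : Fin m} → toℕ i ≤ toℕ j → toℕ (opposite j) ≤ toℕ (opposite i)
opposite-anti {m} {i} {j} le = subst₂ _≤_ (≡.sym (opposite-prop j)) (≡.sym (opposite-prop i))
  (∸-monoʳ-≤ m (s≤s le))
  where open ≡ using (subst₂)

opposite-injective : ∀ {m} {i j : Fin m} → opposite i ≡ opposite j → i ≡ j
opposite-injective {i = i} {j} e =
  trans (≡.sym (opposite-involutive i)) (trans (cong opposite e) (opposite-involutive j))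

module _ (G : Graph) (S : VSet G) where

  restrict : InducedSubgraph G
  restrict = record
    { H = record
      { n = countF S
      ; adj = λ a b → adj G (enum S a) (enum S b)
      ; sym = λ a b → sym G (enum S a) (enum S b)
      ; irrefl = λ a → irrefl G (enum S a)
      }
    ; emb = enum S
    ; emb-inj = enum-injective S
    ; induced = λ _ _ → refl
    }

  V⁺ : ∀ x → x ∈ S → x ∈ V[ restrict ]
  V⁺ x h with a , e ← enum-surjective S x h = anyF⁺ (λ a → ⌊ enum S a ≟ x ⌋) a (⌊⌋⁺ (enum S a ≟ x) e)

  V⁻ : ∀ x → x ∈ V[ restrict ] → x ∈ S
  V⁻ x h with a , e ← anyF⁻ (λ a → ⌊ enum S a ≟ x ⌋) h =
    subst (_∈ S) (⌊⌋⁻ (enum S a ≟ x) e) (enum-∈ S a)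

  restrict-connected : ConnectedSet G S → ConnectedSet (H restrict) full
  restrict-connected c a b _ _ = pull (c _ _ (enum-∈ S a) (enum-∈ S b)) a b refl refl
    where
    pull : ∀ {u v} → Walk G S u v → ∀ a b → enum S a ≡ u → enum S b ≡ v → Walk (H restrict) full a b
    pull (stop _) a b p q with refl ← enum-injective S (trans p (≡.sym q)) = stop refl
    pull (step _ e w) a b refl q with a′ , refl ← enum-surjective S _ (walk-source w) =
      step refl e (pull w a′ b refl q)

  -- The image in `G` of a spanning set `X` is a spanning subset of `S`, hence all of `S`; as
  -- `enum S` is injective, `X` is everything.
  restrict-minimal : ∀ {k} (a : Fin k → Vtx G) (a∈ : ∀ l → a l ∈ S) →
    (∀ Z → Z ⊆ S → Spans G a Z → S ⊆ Z) →
    Minimal (H restrict) (λ l → proj₁ (enum-surjective S (a l) (a∈ l)))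
  restrict-minimal a a∈ least X (cX , aX) b =
    back b (∈⁻ Z? (enum S b) (least ⟦ Z? ⟧ Z⊆ (Z-connected , a∈Z) (enum S b) (enum-∈ S b)))
    where
    Z? = λ x → any? λ c → (c ∈? X) ×-dec (enum S c ≟ x)
    Z⁺ : ∀ c → c ∈ X → enum S c ∈ ⟦ Z? ⟧
    Z⁺ c h = ∈⁺ Z? (enum S c) (c , h , refl)
    push : ∀ {c d} → Walk (H restrict) X c d → Walk G ⟦ Z? ⟧ (enum S c) (enum S d)
    push (stop p) = stop (Z⁺ _ p)
    push (step p e w) = step (Z⁺ _ p) e (push w)
    Z⊆ : ⟦ Z? ⟧ ⊆ S
    Z⊆ x h with c , _ , refl ← ∈⁻ Z? x h = enum-∈ S c
    Z-connected : ConnectedSet G ⟦ Z? ⟧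
    Z-connected u v p q with c , c∈ , refl ← ∈⁻ Z? u p | d , d∈ , refl ← ∈⁻ Z? v q = push (cX c d c∈ d∈)
    a∈Z : ∀ l → a l ∈ ⟦ Z? ⟧
    a∈Z l = ∈⁺ Z? (a l) (_ , aX l , proj₂ (enum-surjective S (a l) (a∈ l)))
    back : ∀ b → ∃[ c ] (c ∈ X × enum S c ≡ enum S b) → b ∈ X
    back b (c , c∈ , e) with refl ← enum-injective S e = c∈

  restrict-neighbours : ∀ v → countF (λ a → adj G v (enum S a)) ≤ countF (λ x → S x ∧ adj G v x)
  restrict-neighbours v = count≤count (λ a → adj G v (enum S a)) (λ x → S x ∧ adj G v x)
    (λ a e → enum S a , ∧⁺ (enum-∈ S a) e) (λ _ _ _ _ → enum-injective S)

module Assemble {G : Graph} {t m : ℕ} (noK : ¬ (K (4 + t) ≼ G)) (st : State G t m)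
                (all : ∀ x → ¬ Rest G (State.s st) x) where
  open State st

  -- The construction stores the most recent part first, so the order is reversed.
  pieces : Fin m → VSet G
  pieces i = s (opposite i)

  P : ConnectedPartition G
  P = record
    { ℓ = m
    ; part = λ i → restrict G (pieces i)
    ; connected = λ i → size i , restrict-connected G (pieces i) (linked (opposite i))
    ; disjoint = λ i j a b e → opposite-injective (disj (opposite i) (opposite j) _
        (enum-∈ (pieces i) a) (subst (_∈ pieces j) (≡.sym e) (enum-∈ (pieces j) b)))
    ; covers = cov
    }
    where
    size : ∀ i → 1 ≤ countF (pieces i)
    size i with x , h ← inhabited (opposite i) with a , _ ← enum-surjective (pieces i) x h =
      ≤-<-trans z≤n (toℕ<n a)
    cov : ∀ x → ∃[ i ] ∃[ a ] enum (pieces i) a ≡ x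
    cov x with any? (λ j → x ∈? s j)
    ... | no none = ⊥-elim (all x λ j h → none (j , h))
    ... | yes (j , h) = opposite j , enum-surjective (pieces (opposite j)) x
      (subst (λ j → x ∈ s j) (≡.sym (opposite-involutive j)) h)

  removed⁺ : ∀ i j x → toℕ j ≤ toℕ i → x ∈ pieces j → x ∈ removed P i
  removed⁺ i j x le h = anyF⁺ (λ j → (toℕ j ≤ᵇ toℕ i) ∧ V[ restrict G (pieces j) ] x) j
    (∧⁺ (≤ᵇ⁺ le) (V⁺ G (pieces j) x h))

  after⁺ : ∀ i x → not (removed P i x) ≡ true → After G s (opposite i) x
  after⁺ i x h j le x∈ = not⁻ h (removed⁺ i (opposite j) x
    (subst (toℕ (opposite j) ≤_) (cong toℕ (opposite-involutive i)) (opposite-anti le))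
    (subst (λ j → x ∈ s j) (≡.sym (opposite-involutive j)) x∈))

  after⁻ : ∀ i x → After G s (opposite i) x → not (removed P i x) ≡ true
  after⁻ i x h = not⁺ λ r →
    let j , e = anyF⁻ (λ j → (toℕ j ≤ᵇ toℕ i) ∧ V[ restrict G (pieces j) ] x) r
        le , x∈ = ∧⁻ e
    in h (opposite j) (opposite-anti (≤ᵇ⁻ le)) (V⁻ G (pieces j) x x∈)

  component⇒comp : ∀ i C → IsComponentAfter P i C → Comp G (After G s (opposite i)) C
  component⇒comp i C (ne , inside , conn , closed) = record
    { inhabited = ne
    ; inside = λ x p → after⁺ i x (inside x p)
    ; linked = conn
    ; closed = λ x y p q → closed x y p (after⁻ i y q)
    }

  adjacent⇒ : ∀ X j → adjSets G X V[ part P j ] ≡ true → adjSets G X (pieces j) ≡ true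
  adjacent⇒ X j = adjSets-mono G {X} {X} {V[ part P j ]} {pieces j} (λ _ p → p) (V⁻ G (pieces j))

  pairwise-adjacent : ∀ i C → IsComponentAfter P i C → ∀ j k → toℕ j ≤ toℕ i → toℕ k ≤ toℕ i → j ≢ k →
    adjSets G C V[ part P j ] ≡ true → adjSets G C V[ part P k ] ≡ true →
    adjSets G (pieces j) (pieces k) ≡ true
  pairwise-adjacent i C comp j k p q ne ej ek =
    before (opposite i) C (component⇒comp i C comp) (opposite j) (opposite k)
      (opposite-anti p) (opposite-anti q) (ne ∘ opposite-injective) (adjacent⇒ C j ej) (adjacent⇒ C k ek)

  few : ∀ i C → IsComponentAfter P i C → numAdjacent P i C ≤ 2 + t
  few i C comp@(ne , inside , conn , _) = few-adjacent G noK pieces (linked ∘ opposite)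
    (λ j k x p q → opposite-injective (disj (opposite j) (opposite k) x p q))
    (λ j → (toℕ j ≤ᵇ toℕ i) ∧ adjSets G C V[ part P j ]) ne conn
    (λ j h → let le , e = ∧⁻ h in
      (λ x p → after⁺ i x (inside x p) (opposite j) (opposite-anti (≤ᵇ⁻ le))) , adjacent⇒ C j e)
    (λ j k p q ne → let le , e = ∧⁻ p ; le′ , e′ = ∧⁻ q in
      pairwise-adjacent i C comp j k (≤ᵇ⁻ le) (≤ᵇ⁻ le′) ne e e′)

  module Part (i : Fin m) where
    S = pieces i
    Hᵢ = H (part P i)

    a : Fin (2 + t) → Vtx Hᵢ
    a l = proj₁ (enum-surjective S _ (proj₁ (proj₂ (hull (opposite i))) l))

    conn : ConnectedSet Hᵢ full
    conn = restrict-connected G S (linked (opposite i))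

    min : Minimal Hᵢ a
    min = restrict-minimal G S _ (proj₁ (proj₂ (hull (opposite i)))) (proj₂ (proj₂ (hull (opposite i))))

    path : PathwidthAtMost Hᵢ (1 + t)
    path = bandwidth⇒pathwidth (bandwidth<terminals a conn min)

theorem11 : (t : ℕ) → 4 ≤ t → (G : Graph) → ¬ (K t ≼ G) →
    Σ (ConnectedPartition G) λ P →
    HasWidth P (t ∸ 2) ×
    (∀ (i : Fin (ℓ P)) →
    (MaxDegreeAtMost (H (part P i)) (t ∸ 2) ×
    BandwidthAtMost (H (part P i)) (t ∸ 3) ×
    PathwidthAtMost (H (part P i)) (t ∸ 3) ×
    TreewidthAtMost (H (part P i)) (t ∸ 3) ×
    Clustered2Colourable (H (part P i)) ⌈ t ∸ 2 /2⌉ ×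
    RedBlue (H (part P i)) (t ∸ 4) (t ∸ 3)) ×
    (∀ C → IsComponentAfter P i C →
    (numAdjacent P i C ≤ t ∸ 2 ×
    (∀ (j k : Fin (ℓ P)) → toℕ j ≤ toℕ i → toℕ k ≤ toℕ i → j ≢ k →
    adjSets G C V[ part P j ] ≡ true → adjSets G C V[ part P k ] ≡ true →
    adjSets G V[ part P j ] V[ part P k ] ≡ true)) ×
    (∀ v → C v ≡ true → ∀ (j : Fin (ℓ P)) → toℕ j ≤ toℕ i →
    nbrsIn P j v ≤ 2 * t ∸ 6)))
-- From here `t` is the excess over 4, so the truncated differences compute to `2 + t`, `1 + t` and
-- `t`.
theorem11 .(4 + t) (s≤s (s≤s (s≤s (s≤s (z≤n {t}))))) G noK with m , st , all ← partition G noK =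
  P , (λ i _ → few i) , λ i → properties i , λ C comp →
    ( few i C comp
    , λ j k p q ne ej ek → adjSets-mono G {pieces j} {V[ part P j ]} {pieces k} {V[ part P k ]}
        (V⁺ G (pieces j)) (V⁺ G (pieces k)) (pairwise-adjacent i C comp j k p q ne ej ek)) ,
    λ v v∈ j le → ≤-trans (restrict-neighbours G (pieces j) v)
      -- `v` avoids all parts up to `i`, in particular those up to `j`.
      (State.attached st (opposite j) v λ l le′ →
        Comp.inside (component⇒comp i C comp) v v∈ l (≤-trans (opposite-anti le) le′))
  where
  open Assemble noK st all
  properties : ∀ i → _
  properties i = degree≤terminals a conn min , bandwidth<terminals a conn min , path ,
    pathwidth⇒treewidth (proj₁ (connected P i)) path ,
    clustered-terminals a conn min , redBlue-terminals a conn min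
    where open Part i
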